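{- For all positive integers $m,h,p$ and every integer $k$, $$hm^{p}S_{p}^{(k)}(h,m)+mh^{p}S_{p}^{(k)}(m,h)=\sum_{\mu=0}^{m-1}\sum_{j=0}^{p}\sum_{\nu=0}^{h-1}\sum_{l=1}^{p-j+1}\frac{(mh)^{j-1}\binom{p}{j}S_{1}(p-j+1,l)}{(p-j+1)\,l^{k-1}}\big((\mu h)m^{p-j}+(m\nu)h^{p-j}\big)\overline{B}_{j}\Big(\frac{\nu}{h}+\frac{\mu}{m}\Big).$$
   Context: For $k\in\mathbb{Z}$, the polyexponential function of index $k$ is $\mathrm{Ei}_{k}(x)=\sum_{n=1}^{\infty}\frac{x^{n}}{n^{k}(n-1)!}$. The type 2 poly-Bernoulli polynomials of index $k$, $B_n^{(k)}(x)$, are defined by the (formal power series in $t$) identity $\frac{\mathrm{Ei}_{k}(\log(1+t))}{e^{t}-1}e^{xt}=\sum_{n=0}^{\infty}B_{n}^{(k)}(x)\frac{t^{n}}{n!}$. The Bernoulli polynomials $B_n(x)$ are defined by $\frac{t}{e^{t}-1}e^{xt}=\sum_{n=0}^{\infty}B_{n}(x)\frac{t^{n}}{n!}$. For real $x$, $\langle x\rangle=x-[x]$ is the fractional part, where $[x]$ is the greatest integer not exceeding $x$; $\overline{B}_n(x)=B_n(\langle x\rangle)$ and $\overline{B}_n^{(k)}(x)=B_n^{(k)}(\langle x\rangle)$. For positive integers $h,m,p$ and $k\in\mathbb{Z}$, the poly-Dedekind sum is $S_{p}^{(k)}(h,m)=\sum_{\mu=1}^{m-1}\frac{\mu}{m}\,\overline{B}_{p}^{(k)}\big(\frac{h\mu}{m}\big)$.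 $S_1(n,l)$ denotes the (signed) Stirling numbers of the first kind, given by $\frac{(\log(1+t))^{l}}{l!}=\sum_{n=l}^{\infty}S_1(n,l)\frac{t^n}{n!}$. -}

module Defs where

open import Algebra.Bundles using (CommutativeRing)
open import Data.Fin.Base using (toℕ)
open import Data.Integer.Base as ℤ using (ℤ; +_; -[1+_])
open import Data.Nat.Base as ℕ using (ℕ; zero; suc; _∸_; _!)
import Data.Nat.Properties as ℕ
open import Data.Rational.Base
open import Data.Rational.Properties
open import Relation.Binary.PropositionalEquality

open import Algebra.Properties.CommutativeMonoid.Sum +-0-commutativeMonoid public
  using (sum)
open import Algebra.Properties.Semiring.Exp
  (CommutativeRing.semiring +-*-commutativeRing) public
  using (_^_)

∑< : ℕ → (ℕ → ℚ) → ℚ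
∑< n f = sum {n} (λ i → f (toℕ i))

infixl 6 ∑<
syntax ∑< n (λ i → x) = ∑[ i < n ] x

-- The index i runs over 1, …, n, and a proof that it is nonzero is
-- available to instance search in the summand.
∑₁ : ℕ → ((i : ℕ) .{{_ : ℕ.NonZero i}} → ℚ) → ℚ
∑₁ n f = sum {n} (λ i → f (suc (toℕ i)))

infixl 6 ∑₁
syntax ∑₁ n (λ i → x) = ∑[1≤ i ≤ n ] x

fromℕ : ℕ → ℚ
fromℕ n = + n / 1

infixr 8 _^ℤ_

_^ℤ_ : (n : ℕ) .{{_ : ℕ.NonZero n}} → ℤ → ℚ
n ^ℤ (+ a)    = fromℕ (n ℕ.^ a)
n ^ℤ -[1+ a ] = _/_ (+ 1) (n ℕ.^ suc a) {{ℕ.m^n≢0 n (suc a)}}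

1/! : ℕ → ℚ
1/! n = _/_ (+ 1) (n !) {{n ℕ.!≢0}}

-- A formal power series in t over ℚ: the value at n is the coefficient
-- of tⁿ.
Series : Set
Series = ℕ → ℚ

-- n! times the coefficient of tⁿ, so that f = ∑ₙ (egf f n) tⁿ/n!.
egf : Series → ℕ → ℚ
egf f n = fromℕ (n !) * f n

1ₛ : Series
1ₛ zero    = 1ℚ
1ₛ (suc n) = 0ℚ

t : Series
t zero          = 0ℚ
t (suc zero)    = 1ℚ
t (suc (suc n)) = 0ℚ

infixl 6 _-ₛ_
_-ₛ_ : Series → Series → Series
(f -ₛ g) n = f n - g n

infixl 7 _*ₛ_
_*ₛ_ : Series → Series → Series
(f *ₛ g) n = ∑[ i < suc n ] f i * g (n ∸ i)

infixr 8 _^ₛ_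
_^ₛ_ : Series → ℕ → Series
f ^ₛ zero  = 1ₛ
f ^ₛ suc l = f *ₛ f ^ₛ l

-- f(g(t)), for g without constant term: then g^l has no terms of degree
-- below l, so only l ≤ n contributes to the coefficient of tⁿ.
infixr 9 _∘ₛ_
_∘ₛ_ : Series → Series → Series
(f ∘ₛ g) n = ∑[ l < suc n ] f l * (g ^ₛ l) n

-- Long division f / g, for g with nonzero constant term g₀: with
-- q₀ = f₀ / g₀, the quotient is q₀ + t · ((f - q₀ g)/t) / g.
quotient : (f g : Series) .{{_ : NonZero (g 0)}} → Series
quotient f g zero    = f 0 ÷ g 0
quotient f g (suc n) =
  quotient (λ i → f (suc i) - (f 0 ÷ g 0) * g (suc i)) g n

quotient-*ₛ : ∀ f g .{{_ : NonZero (g 0)}} n → (quotient f g *ₛ g) n ≡ f n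
quotient-*ₛ f g zero    = begin
  f 0 * 1/ g 0 * g 0 + 0ℚ  ≡⟨ +-identityʳ _ ⟩
  f 0 * 1/ g 0 * g 0       ≡⟨ *-assoc (f 0) _ _ ⟩
  f 0 * (1/ g 0 * g 0)     ≡⟨ cong (f 0 *_) (*-inverseˡ (g 0)) ⟩
  f 0 * 1ℚ                 ≡⟨ *-identityʳ (f 0) ⟩
  f 0                      ∎
  where open ≡-Reasoning
quotient-*ₛ f g (suc n) = begin
  c + (quotient f′ g *ₛ g) n  ≡⟨ cong (_+_ c) (quotient-*ₛ f′ g n) ⟩
  c + (f (suc n) - c)         ≡⟨ cong (_+_ c) (+-comm (f (suc n)) (- c)) ⟩
  c + (- c + f (suc n))       ≡⟨ +-assoc c (- c) _ ⟨
  c - c + f (suc n)           ≡⟨ cong (_+ f (suc n)) (+-inverseʳ c) ⟩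
  0ℚ + f (suc n)              ≡⟨ +-identityˡ _ ⟩
  f (suc n)                   ∎
  where
  open ≡-Reasoning
  f′ : Series
  f′ i = f (suc i) - (f 0 ÷ g 0) * g (suc i)
  c = (f 0 ÷ g 0) * g (suc n)

-- f / g, for f and g both without constant term and g with nonzero linear
-- term, as (f/t) / (g/t).
infixl 7 _/ₛ_
_/ₛ_ : (f g : Series) .{{_ : NonZero (g 1)}} → Series
f /ₛ g = quotient (λ n → f (suc n)) (λ n → g (suc n))

-- e^{xt}
exp : ℚ → Series
exp x n = x ^ n * 1/! n

-- log (1 + t) = ∑_{n ≥ 1} (-1)^{n-1} tⁿ/n
log[1+t] : Series
log[1+t] zero    = 0ℚ
log[1+t] (suc n) = (- 1ℚ) ^ n * (+ 1 / suc n)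

-- ∑_{n ≥ 1} tⁿ / (n^k (n-1)!)
Ei : ℤ → Series
Ei k zero    = 0ℚ
Ei k (suc n) = suc n ^ℤ (ℤ.- k) * 1/! n

-- The Bernoulli polynomials, as functions of x ∈ ℚ.
B : ℕ → ℚ → ℚ
B n x = egf (t /ₛ (exp 1ℚ -ₛ 1ₛ) *ₛ exp x) n

-- The type 2 poly-Bernoulli polynomials of index k, as functions of x ∈ ℚ.
polyB : ℤ → ℕ → ℚ → ℚ
polyB k n x = egf (Ei k ∘ₛ log[1+t] /ₛ (exp 1ℚ -ₛ 1ₛ) *ₛ exp x) n

-- x - [x]; the library's fracPart truncates towards zero instead.
⟨_⟩ : ℚ → ℚ
⟨ x ⟩ = x - floor x / 1

B̄ : ℕ → ℚ → ℚ
B̄ n x = B n ⟨ x ⟩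

polyB̄ : ℤ → ℕ → ℚ → ℚ
polyB̄ k n x = polyB k n ⟨ x ⟩

polyDedekindSum : ℤ → ℕ → (h m : ℕ) .{{_ : ℕ.NonZero m}} → ℚ
polyDedekindSum k p h m =
  ∑[1≤ μ ≤ m ∸ 1 ] (+ μ / m) * polyB̄ k p (+ (h ℕ.* μ) / m)

-- Signed Stirling numbers of the first kind: (log (1+t))^l / l! is the
-- exponential generating function of n ↦ S₁ n l.
S₁ : ℕ → ℕ → ℚ
S₁ n l = egf (λ i → (log[1+t] ^ₛ l) i * 1/! l) n

-- Ei_k(log(1+t)) has exponential coefficients ∑_l S₁(n,l) l^{1-k}, so the type 2
-- poly-Bernoulli polynomials are the binomial convolution of
-- A_n = ∑_l S₁(n+1,l) l^{1-k} / (n+1) with the Bernoulli polynomials.  Each of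
-- the two Dedekind sums is therefore a combination of the B̄_j(hμ/m), and
-- Raabe's multiplication formula
--
--   h^{-j} B̄_j(hx) = h^{-1} ∑_{ν<h} B̄_j(x + ν/h)
--
-- turns both into double sums over the same points ν/h + μ/m.  For the
-- polynomials B_j it comes from the geometric sum
-- e^t - 1 = (e^{t/h} - 1) ∑_{ν<h} e^{νt/h}; for B̄_j the right-hand side is
-- invariant under x ↦ x + 1/h, so x may be taken in [0, 1/h), where no
-- fractional part intervenes.

module Submission where

open import Defs
open import Algebra.Bundles using (CommutativeMonoid; CommutativeRing)
open import Data.Fin.Base using (toℕ)
open import Data.Fin.Properties using (toℕ<n)
open import Data.Integer.Base as ℤ using (ℤ; +_; -[1+_])
import Data.Integer.DivMod as ℤ
import Data.Integer.Properties as ℤ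
open import Data.Nat.Base as ℕ using (ℕ; zero; suc; _∸_; _!; NonZero)
open import Data.Nat.Combinatorics using (_C_; nCk≡n!/k![n-k]!; k![n∸k]!∣n!)
open import Data.Nat.DivMod using (m/n*n≡m)
open import Data.Nat.Properties using (m*n≢0)
import Data.Nat.Properties as ℕ
open import Data.Product.Base using (_,_)
open import Data.Rational.Base
  using (ℚ; 0ℚ; 1ℚ; nonNegative; _+_; _*_; _-_; -_; _/_; _≤_; _<_; floor; toℚᵘ)
open import Data.Rational.Properties
open import Data.Rational.Solver
open import Data.Rational.Unnormalised.Base as ℚᵘ using (mkℚᵘ)
import Data.Rational.Unnormalised.Properties as ℚᵘ
open import Relation.Binary.PropositionalEquality
import Relation.Binary.Reasoning.Setoid as SetoidReasoning
import Algebra.Properties.CommutativeSemigroup as CommutativeSemigroupProperties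

open import Algebra.Properties.CommutativeMonoid.Sum +-0-commutativeMonoid
  using (sum-cong-≗; ∑-distrib-+; ∑-comm)
open import Algebra.Properties.Semiring.Sum
  (CommutativeRing.semiring +-*-commutativeRing)
  using (*-distribˡ-sum; *-distribʳ-sum)
open import Algebra.Properties.Semiring.Exp
  (CommutativeRing.semiring +-*-commutativeRing)
  using (^-homo-*)
open import Algebra.Properties.CommutativeSemiring.Exp
  (CommutativeRing.commutativeSemiring +-*-commutativeRing)
  using (^-distrib-*)
import Algebra.Properties.CommutativeSemiring.Binomial
  (CommutativeRing.commutativeSemiring +-*-commutativeRing) as Binomial
open import Algebra.Properties.Monoid.Mult +-0-monoid using (_×_)

open +-*-Solver using (solve; _:=_; _:+_; _:*_; _:-_; con)

-- Fractional parts

fromℤ : ℤ → ℚ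
fromℤ z = z / 1

-- `_/_` reduces to lowest terms, which blocks direct computation. Identities between fractions are
-- therefore moved to unnormalised rationals, where equality is integer cross-multiplication.
toℚᵘ-/ : ∀ z n .{{_ : NonZero n}} → toℚᵘ (z / n) ℚᵘ.≃ (z ℚᵘ./ n)
toℚᵘ-/ z (suc n) = toℚᵘ-fromℚᵘ (mkℚᵘ z n)

fromℤ-+ : ∀ a b → fromℤ (a ℤ.+ b) ≡ fromℤ a + fromℤ b
fromℤ-+ a b = toℚᵘ-injective (begin
  toℚᵘ (fromℤ (a ℤ.+ b))            ≈⟨ toℚᵘ-/ (a ℤ.+ b) 1 ⟩
  mkℚᵘ (a ℤ.+ b) 0
    ≡⟨ cong (λ c → mkℚᵘ c 0) (cong₂ ℤ._+_ (ℤ.*-identityʳ a) (ℤ.*-identityʳ b)) ⟨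
  mkℚᵘ a 0 ℚᵘ.+ mkℚᵘ b 0            ≈⟨ ℚᵘ.+-cong (toℚᵘ-/ a 1) (toℚᵘ-/ b 1) ⟨
  toℚᵘ (fromℤ a) ℚᵘ.+ toℚᵘ (fromℤ b) ≈⟨ toℚᵘ-homo-+ (fromℤ a) (fromℤ b) ⟨
  toℚᵘ (fromℤ a + fromℤ b)          ∎)
  where open ℚᵘ.≃-Reasoning

fromℤ-cancel-< : ∀ {a b} → fromℤ a < fromℤ b → a ℤ.< b
fromℤ-cancel-< {a} {b} a<b
  with ℚᵘ.*<* lt ← ℚᵘ.<-respˡ-≃ (toℚᵘ-/ a 1) (ℚᵘ.<-respʳ-≃ (toℚᵘ-/ b 1) (toℚᵘ-mono-< a<b))
  = subst₂ ℤ._<_ (ℤ.*-identityʳ a) (ℤ.*-identityʳ b) lt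

-- `floor` divides the numerator by the positive denominator, rounding down, so clearing the
-- denominator leaves the standard bound on integer quotients. Matching on `record{}` lets `floor`
-- unfold.
fromℤ-floor-≤ : ∀ x → fromℤ (floor x) ≤ x
fromℤ-floor-≤ x@record{} = toℚᵘ-cancel-≤ (ℚᵘ.≤-respˡ-≃ (ℚᵘ.≃-sym (toℚᵘ-/ (floor x) 1))
  (ℚᵘ.*≤* (subst (floor x ℤ.* ℚ.denominator x ℤ.≤_) (sym (ℤ.*-identityʳ (ℚ.numerator x)))
    (ℤ.[n/d]*d≤n (ℚ.numerator x) (ℚ.denominator x)))))

<-fromℤ-floor+1 : ∀ x → x < fromℤ (floor x ℤ.+ + 1)
<-fromℤ-floor+1 x@record{} = toℚᵘ-cancel-< (ℚᵘ.<-respʳ-≃ (ℚᵘ.≃-sym (toℚᵘ-/ (floor x ℤ.+ + 1) 1))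
  (ℚᵘ.*<* (subst₂ ℤ._<_ (sym (ℤ.*-identityʳ (ℚ.numerator x)))
     (cong (ℤ._* ℚ.denominator x) eq)
    (ℤ.n<s[n/ℕd]*d (ℚ.numerator x) (ℚ.denominatorℕ x)))))
  where
  q = ℚ.numerator x ℤ./ℕ ℚ.denominatorℕ x
  -- The strict bound speaks of division by a natural number, `floor` of division by a positive
  -- integer; both give the same quotient.
  eq : ℤ.suc q ≡ floor x ℤ.+ + 1
  eq = trans (ℤ.+-comm (+ 1) q)
    (cong (ℤ._+ + 1) (sym (ℤ.div-pos-is-/ℕ (ℚ.numerator x) (ℚ.denominatorℕ x))))

0≤⟨⟩ : ∀ x → 0ℚ ≤ ⟨ x ⟩
0≤⟨⟩ x = subst (_≤ ⟨ x ⟩) (+-inverseʳ (fromℤ (floor x)))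
  (+-monoˡ-≤ (- fromℤ (floor x)) (fromℤ-floor-≤ x))

⟨⟩<1 : ∀ x → ⟨ x ⟩ < 1ℚ
⟨⟩<1 x = subst (⟨ x ⟩ <_) (trans (cong (_- w) (fromℤ-+ (floor x) (+ 1)))
  (solve 2 (λ a b → a :+ b :- a := b) refl w 1ℚ))
  (+-monoˡ-< (- w) (<-fromℤ-floor+1 x))
  where w = fromℤ (floor x)

⟨⟩+floor : ∀ x → ⟨ x ⟩ + fromℤ (floor x) ≡ x
⟨⟩+floor x = solve 2 (λ a b → a :- b :+ b := a) refl x (fromℤ (floor x))

-- For `x = y + fromℤ z`, both `z` and `floor x` are integers n with n ≤ x < n + 1. Each is then
-- below the other plus one, so they agree by antisymmetry.
⟨⟩-unique : ∀ y z → 0ℚ ≤ y → y < 1ℚ → ⟨ y + fromℤ z ⟩ ≡ y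
⟨⟩-unique y z 0≤y y<1 = trans (cong (λ a → x - fromℤ a) (ℤ.≤-antisym w≤z z≤w))
  (solve 2 (λ a b → a :+ b :- b := a) refl y (fromℤ z))
  where
  x = y + fromℤ z
  z≤x : fromℤ z ≤ x
  z≤x = subst (_≤ x) (+-identityˡ (fromℤ z)) (+-monoˡ-≤ (fromℤ z) 0≤y)
  x<z+1 : x < fromℤ (z ℤ.+ + 1)
  x<z+1 = subst (x <_) (trans (+-comm 1ℚ (fromℤ z)) (sym (fromℤ-+ z (+ 1)))) (+-monoˡ-< (fromℤ z) y<1)
  ≤-from : ∀ {a b} → fromℤ a < fromℤ (b ℤ.+ + 1) → a ℤ.≤ b
  ≤-from {a} {b} lt = subst (a ℤ.≤_) (ℤ.pred-suc b)
    (ℤ.i<j⇒i≤pred[j] (subst (a ℤ.<_) (ℤ.+-comm b (+ 1)) (fromℤ-cancel-< lt)))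
  z≤w : z ℤ.≤ floor x
  z≤w = ≤-from (≤-<-trans z≤x (<-fromℤ-floor+1 x))
  w≤z : floor x ℤ.≤ z
  w≤z = ≤-from (≤-<-trans (fromℤ-floor-≤ x) x<z+1)

⟨⟩-small : ∀ y → 0ℚ ≤ y → y < 1ℚ → ⟨ y ⟩ ≡ y
⟨⟩-small y 0≤y y<1 = trans (cong ⟨_⟩ (sym (+-identityʳ y))) (⟨⟩-unique y (+ 0) 0≤y y<1)

⟨⟩-periodic : ∀ x → ⟨ x + 1ℚ ⟩ ≡ ⟨ x ⟩
⟨⟩-periodic x = trans (cong ⟨_⟩ eq) (⟨⟩-unique ⟨ x ⟩ (floor x ℤ.+ + 1) (0≤⟨⟩ x) (⟨⟩<1 x))
  where
  r = ⟨ x ⟩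
  n = floor x
  eq : x + 1ℚ ≡ r + fromℤ (n ℤ.+ + 1)
  eq = begin
    x + 1ℚ                    ≡⟨ cong (_+ 1ℚ) (⟨⟩+floor x) ⟨
    r + fromℤ n + 1ℚ          ≡⟨ +-assoc r (fromℤ n) 1ℚ ⟩
    r + (fromℤ n + 1ℚ)        ≡⟨ cong (_+_ r) (fromℤ-+ n (+ 1)) ⟨
    r + fromℤ (n ℤ.+ + 1)     ∎
    where open ≡-Reasoning

-- Natural numbers and unit fractions in ℚ

fromℕ-+ : ∀ a b → fromℕ (a ℕ.+ b) ≡ fromℕ a + fromℕ b
fromℕ-+ a b = trans (cong fromℤ (ℤ.pos-+ a b)) (fromℤ-+ (+ a) (+ b))

fromℕ-* : ∀ a b → fromℕ (a ℕ.* b) ≡ fromℕ a * fromℕ b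
fromℕ-* zero    b = sym (*-zeroˡ (fromℕ b))
fromℕ-* (suc a) b = begin
  fromℕ (b ℕ.+ a ℕ.* b)           ≡⟨ fromℕ-+ b (a ℕ.* b) ⟩
  fromℕ b + fromℕ (a ℕ.* b)       ≡⟨ cong (_+_ (fromℕ b)) (fromℕ-* a b) ⟩
  fromℕ b + fromℕ a * fromℕ b     ≡⟨ cong (_+ fromℕ a * fromℕ b) (*-identityˡ (fromℕ b)) ⟨
  1ℚ * fromℕ b + fromℕ a * fromℕ b ≡⟨ *-distribʳ-+ (fromℕ b) 1ℚ (fromℕ a) ⟨
  (1ℚ + fromℕ a) * fromℕ b        ≡⟨ cong (_* fromℕ b) (fromℕ-+ 1 a) ⟨
  fromℕ (suc a) * fromℕ b         ∎
  where open ≡-Reasoning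

fromℕ-^ : ∀ a n → fromℕ (a ℕ.^ n) ≡ fromℕ a ^ n
fromℕ-^ a zero    = refl
fromℕ-^ a (suc n) = trans (fromℕ-* a (a ℕ.^ n)) (cong (fromℕ a *_) (fromℕ-^ a n))

-- Separating the numerator leaves `+ 1 / n` as the only fraction, an atom for the ring solver whose
-- one needed property is `n*1/n≡1`.
/-≡-* : ∀ a n .{{_ : NonZero n}} → + a / n ≡ fromℕ a * (+ 1 / n)
/-≡-* a n@(suc n-1) = toℚᵘ-injective (begin
  toℚᵘ (+ a / n)                      ≈⟨ toℚᵘ-/ (+ a) n ⟩
  mkℚᵘ (+ a) n-1
    ≈⟨ ℚᵘ.*≡* (cong₂ ℤ._*_ (sym (ℤ.*-identityʳ (+ a))) (cong (λ k → + suc k) (ℕ.+-identityʳ n-1))) ⟩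
  mkℚᵘ (+ a) 0 ℚᵘ.* mkℚᵘ (+ 1) n-1    ≈⟨ ℚᵘ.*-cong (toℚᵘ-/ (+ a) 1) (toℚᵘ-/ (+ 1) n) ⟨
  toℚᵘ (fromℕ a) ℚᵘ.* toℚᵘ (+ 1 / n)  ≈⟨ toℚᵘ-homo-* (fromℕ a) (+ 1 / n) ⟨
  toℚᵘ (fromℕ a * (+ 1 / n))          ∎)
  where open ℚᵘ.≃-Reasoning

n/n≡1 : ∀ n .{{_ : NonZero n}} → + n / n ≡ 1ℚ
n/n≡1 n@(suc n-1) = toℚᵘ-injective (ℚᵘ.≃-trans (toℚᵘ-/ (+ n) n) (ℚᵘ.*≡* (ℤ.*-comm (+ n) (+ 1))))

n*1/n≡1 : ∀ n .{{_ : NonZero n}} → fromℕ n * (+ 1 / n) ≡ 1ℚ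
n*1/n≡1 n = trans (sym (/-≡-* n n)) (n/n≡1 n)

-- Finite sums

1^n≡1 : ∀ n → 1ℚ ^ n ≡ 1ℚ
1^n≡1 zero    = refl
1^n≡1 (suc n) = trans (*-identityˡ (1ℚ ^ n)) (1^n≡1 n)

∑<-cong : ∀ n {f g} → (∀ i → i ℕ.< n → f i ≡ g i) → ∑< n f ≡ ∑< n g
∑<-cong n f≡g = sum-cong-≗ {n} (λ i → f≡g (toℕ i) (toℕ<n i))

∑<-comm : ∀ m n (f : ℕ → ℕ → ℚ) →
  ∑[ i < m ] ∑[ j < n ] f i j ≡ ∑[ j < n ] ∑[ i < m ] f i j
∑<-comm m n f = ∑-comm {m} {n} (λ i j → f (toℕ i) (toℕ j))

∑<-+ : ∀ n f g → ∑[ i < n ] (f i + g i) ≡ ∑< n f + ∑< n g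
∑<-+ n f g = ∑-distrib-+ {n} (λ i → f (toℕ i)) (λ i → g (toℕ i))

*-∑< : ∀ n c f → c * ∑< n f ≡ ∑[ i < n ] (c * f i)
*-∑< n c f = *-distribˡ-sum {n} c (λ i → f (toℕ i))

∑<-* : ∀ n c f → ∑< n f * c ≡ ∑[ i < n ] (f i * c)
∑<-* n c f = *-distribʳ-sum {n} c (λ i → f (toℕ i))

∑<-zero : ∀ n f → (∀ i → f i ≡ 0ℚ) → ∑< n f ≡ 0ℚ
∑<-zero zero    f f≡0 = refl
∑<-zero (suc n) f f≡0 = cong₂ _+_ (f≡0 0) (∑<-zero n (λ i → f (suc i)) (λ i → f≡0 (suc i)))

-- Both sides are the sum of f over 0, ..., n. `∑<` peels off its first term by definition; this
-- trades that term for the last one and drives the telescoping and periodicity arguments.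
∑<-suc : ∀ n f → ∑< n (λ i → f (suc i)) + f 0 ≡ ∑< n f + f n
∑<-suc zero    f = refl
∑<-suc (suc n) f = begin
  f 1 + s + f 0                   ≡⟨ cong (_+ f 0) (+-comm (f 1) s) ⟩
  s + f 1 + f 0                   ≡⟨ cong (_+ f 0) (∑<-suc n (λ i → f (suc i))) ⟩
  s′ + f (suc n) + f 0
    ≡⟨ solve 3 (λ a b c → a :+ b :+ c := c :+ a :+ b) refl s′ (f (suc n)) (f 0) ⟩
  f 0 + s′ + f (suc n)            ∎
  where
  open ≡-Reasoning
  s  = ∑[ i < n ] f (suc (suc i))
  s′ = ∑[ i < n ] f (suc i)

-- Formal power series over ℚ

-- A record, so that the two series can be inferred from f ≈ g; with _≗_ they cannot.
infix 4 _≈_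
record _≈_ (f g : Series) : Set where
  constructor pointwise
  field at : f ≗ g

open _≈_

*ₛ-cong : ∀ {f f′ g g′} → f ≈ f′ → g ≈ g′ → f *ₛ g ≈ f′ *ₛ g′
*ₛ-cong f≈f′ g≈g′ .at n = ∑<-cong (suc n) (λ i _ → cong₂ _*_ (at f≈f′ i) (at g≈g′ (n ∸ i)))

*ₛ-congˡ : ∀ f {g g′} → g ≈ g′ → f *ₛ g ≈ f *ₛ g′
*ₛ-congˡ f g≈g′ .at n = ∑<-cong (suc n) (λ i _ → cong (_*_ (f i)) (at g≈g′ (n ∸ i)))

-- The combination c f + g is the shape in which the tail of a product unfolds, as needed for
-- associativity; with c = -1 it also gives distributivity over `_-ₛ_`.
*ₛ-linearˡ : ∀ c f g h n →
  ((λ i → c * f i + g i) *ₛ h) n ≡ c * (f *ₛ h) n + (g *ₛ h) n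
*ₛ-linearˡ c f g h n = begin
  ∑[ i < suc n ] ((c * f i + g i) * h (n ∸ i))
    ≡⟨ ∑<-cong (suc n) (λ i _ → solve 4 (λ c f g h → (c :* f :+ g) :* h := c :* (f :* h) :+ g :* h) refl c (f i) (g i) (h (n ∸ i))) ⟩
  ∑[ i < suc n ] (c * (f i * h (n ∸ i)) + g i * h (n ∸ i))
    ≡⟨ ∑<-+ (suc n) (λ i → c * (f i * h (n ∸ i))) (λ i → g i * h (n ∸ i)) ⟩
  ∑< (suc n) (λ i → c * (f i * h (n ∸ i))) + (g *ₛ h) n
    ≡⟨ cong (_+ (g *ₛ h) n) (*-∑< (suc n) c (λ i → f i * h (n ∸ i))) ⟨
  c * (f *ₛ h) n + (g *ₛ h) n ∎
  where open ≡-Reasoning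

-- The definition of the product peels the constant term off the left factor; this peels it off the
-- right one. Commutativity follows by playing the two against each other.
*ₛ-suc : ∀ f g n → (f *ₛ g) (suc n) ≡ (f *ₛ (λ i → g (suc i))) n + f (suc n) * g 0
*ₛ-suc f g zero    = solve 4 (λ a b c d → a :* b :+ (c :* d :+ con 0ℚ) := a :* b :+ con 0ℚ :+ c :* d) refl (f 0) (g 1) (f 1) (g 0)
*ₛ-suc f g (suc n) = begin
  f 0 * g (2 ℕ.+ n) + (f′ *ₛ g) (suc n)
    ≡⟨ cong (_+_ (f 0 * g (2 ℕ.+ n))) (*ₛ-suc f′ g n) ⟩
  f 0 * g (2 ℕ.+ n) + ((f′ *ₛ g′) n + f (2 ℕ.+ n) * g 0)  ≡⟨ +-assoc (f 0 * g (2 ℕ.+ n)) _ _ ⟨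
  f 0 * g (2 ℕ.+ n) + (f′ *ₛ g′) n + f (2 ℕ.+ n) * g 0    ∎
  where
  open ≡-Reasoning
  f′ g′ : Series
  f′ i = f (suc i)
  g′ i = g (suc i)

*ₛ-comm′ : ∀ f g n → (f *ₛ g) n ≡ (g *ₛ f) n
*ₛ-comm′ f g zero    = cong (_+ 0ℚ) (*-comm (f 0) (g 0))
*ₛ-comm′ f g (suc n) = begin
  f 0 * g (suc n) + ((λ i → f (suc i)) *ₛ g) n
    ≡⟨ cong₂ _+_ (*-comm (f 0) (g (suc n))) (*ₛ-comm′ (λ i → f (suc i)) g n) ⟩
  g (suc n) * f 0 + (g *ₛ (λ i → f (suc i))) n  ≡⟨ +-comm (g (suc n) * f 0) _ ⟩
  (g *ₛ (λ i → f (suc i))) n + g (suc n) * f 0  ≡⟨ *ₛ-suc g f n ⟨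
  (g *ₛ f) (suc n)                              ∎
  where open ≡-Reasoning

-- With f′ and g′ the tails, the tail of `f *ₛ g` is by definition f₀ g′ + f′ g. Linearity separates
-- the two summands, and the induction hypothesis for f′ handles the second.
*ₛ-assoc′ : ∀ f g h n → ((f *ₛ g) *ₛ h) n ≡ (f *ₛ (g *ₛ h)) n
*ₛ-assoc′ f g h zero    = solve 3 (λ a b c → (a :* b :+ con 0ℚ) :* c :+ con 0ℚ := a :* (b :* c :+ con 0ℚ) :+ con 0ℚ) refl (f 0) (g 0) (h 0)
*ₛ-assoc′ f g h (suc n) = begin
  (f 0 * g 0 + 0ℚ) * h (suc n) + ((λ i → f 0 * g′ i + (f′ *ₛ g) i) *ₛ h) n
    ≡⟨ cong (_+_ ((f 0 * g 0 + 0ℚ) * h (suc n))) (*ₛ-linearˡ (f 0) g′ (f′ *ₛ g) h n) ⟩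
  (f 0 * g 0 + 0ℚ) * h (suc n) + (f 0 * (g′ *ₛ h) n + ((f′ *ₛ g) *ₛ h) n)
    ≡⟨ cong (λ x → (f 0 * g 0 + 0ℚ) * h (suc n) + (f 0 * (g′ *ₛ h) n + x)) (*ₛ-assoc′ f′ g h n) ⟩
  (f 0 * g 0 + 0ℚ) * h (suc n) + (f 0 * (g′ *ₛ h) n + (f′ *ₛ (g *ₛ h)) n)
    ≡⟨ solve 5 (λ a b c d e → (a :* b :+ con 0ℚ) :* c :+ (a :* d :+ e) := a :* (b :* c :+ d) :+ e) refl
         (f 0) (g 0) (h (suc n)) ((g′ *ₛ h) n) ((f′ *ₛ (g *ₛ h)) n) ⟩
  f 0 * (g 0 * h (suc n) + (g′ *ₛ h) n) + (f′ *ₛ (g *ₛ h)) n ∎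
  where
  open ≡-Reasoning
  f′ g′ : Series
  f′ i = f (suc i)
  g′ i = g (suc i)

*ₛ-identityˡ′ : ∀ f n → (1ₛ *ₛ f) n ≡ f n
*ₛ-identityˡ′ f zero    = trans (+-identityʳ (1ℚ * f 0)) (*-identityˡ (f 0))
*ₛ-identityˡ′ f (suc n) = trans
  (cong₂ _+_ (*-identityˡ (f (suc n))) (∑<-zero (suc n) (λ i → 0ℚ * f (n ∸ i)) (λ i → *-zeroˡ (f (n ∸ i)))))
  (+-identityʳ (f (suc n)))

*ₛ-1-commutativeMonoid : CommutativeMonoid _ _
*ₛ-1-commutativeMonoid = record
  { _≈_ = _≈_
  ; _∙_ = _*ₛ_
  ; ε   = 1ₛ
  ; isCommutativeMonoid = record
    { isMonoid = record
      { isSemigroup = record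
        { isMagma = record
          { isEquivalence = record
            { refl  = pointwise (λ _ → refl)
            ; sym   = λ p → pointwise (λ n → sym (at p n))
            ; trans = λ p q → pointwise (λ n → trans (at p n) (at q n))
            }
          ; ∙-cong = *ₛ-cong
          }
        ; assoc = λ f g h → pointwise (*ₛ-assoc′ f g h)
        }
      ; identity = (λ f → pointwise (*ₛ-identityˡ′ f))
        , (λ f → pointwise (λ n → trans (*ₛ-comm′ f 1ₛ n) (*ₛ-identityˡ′ f n)))
      }
    ; comm = λ f g → pointwise (*ₛ-comm′ f g)
    }
  }

module ×ₛ = CommutativeMonoid *ₛ-1-commutativeMonoid
open CommutativeSemigroupProperties ×ₛ.commutativeSemigroup using (x∙yz≈y∙xz; xy∙z≈xz∙y)
module ≈-Reasoning = SetoidReasoning ×ₛ.setoid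

-- Scalar multiples, finite sums and dilation of series

infixr 8 _·ₛ_
_·ₛ_ : ℚ → Series → Series
(c ·ₛ f) n = c * f n

·ₛ-cong : ∀ c {f g} → f ≈ g → c ·ₛ f ≈ c ·ₛ g
·ₛ-cong c f≈g .at n = cong (c *_) (at f≈g n)

·ₛ-*ₛ : ∀ c f g → c ·ₛ f *ₛ g ≈ c ·ₛ (f *ₛ g)
·ₛ-*ₛ c f g .at n = begin
  ∑[ i < suc n ] c * f i * g (n ∸ i)
    ≡⟨ ∑<-cong (suc n) (λ i _ → *-assoc c (f i) (g (n ∸ i))) ⟩
  ∑[ i < suc n ] (c * (f i * g (n ∸ i)))  ≡⟨ *-∑< (suc n) c (λ i → f i * g (n ∸ i)) ⟨
  c * (f *ₛ g) n                          ∎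
  where open ≡-Reasoning

*ₛ-·ₛ : ∀ c f g → f *ₛ c ·ₛ g ≈ c ·ₛ (f *ₛ g)
*ₛ-·ₛ c f g = begin
  f *ₛ c ·ₛ g     ≈⟨ ×ₛ.comm f (c ·ₛ g) ⟩
  c ·ₛ g *ₛ f     ≈⟨ ·ₛ-*ₛ c g f ⟩
  c ·ₛ (g *ₛ f)   ≈⟨ ·ₛ-cong c (×ₛ.comm g f) ⟩
  c ·ₛ (f *ₛ g)   ∎
  where open ≈-Reasoning

*ₛ-distribˡ--ₛ : ∀ f g h → f *ₛ (g -ₛ h) ≈ f *ₛ g -ₛ f *ₛ h
*ₛ-distribˡ--ₛ f g h .at n = begin
  (f *ₛ (g -ₛ h)) n                      ≡⟨ *ₛ-comm′ f (g -ₛ h) n ⟩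
  ((g -ₛ h) *ₛ f) n
    ≡⟨ at (*ₛ-cong {f = g -ₛ h} {g = f}
         (pointwise λ i → solve 2 (λ a b → a :- b := con (- 1ℚ) :* b :+ a) refl (g i) (h i)) ×ₛ.refl) n ⟩
  ((λ i → - 1ℚ * h i + g i) *ₛ f) n      ≡⟨ *ₛ-linearˡ (- 1ℚ) h g f n ⟩
  - 1ℚ * (h *ₛ f) n + (g *ₛ f) n
    ≡⟨ cong₂ (λ a b → - 1ℚ * a + b) (*ₛ-comm′ h f n) (*ₛ-comm′ g f n) ⟩
  - 1ℚ * (f *ₛ h) n + (f *ₛ g) n
    ≡⟨ solve 2 (λ a b → con (- 1ℚ) :* a :+ b := b :- a) refl ((f *ₛ h) n) ((f *ₛ g) n) ⟩
  (f *ₛ g) n - (f *ₛ h) n                ∎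
  where open ≡-Reasoning

∑ₛ : ℕ → (ℕ → Series) → Series
∑ₛ N F n = ∑[ ν < N ] F ν n

∑ₛ-*ₛ : ∀ N F g → ∑ₛ N F *ₛ g ≈ ∑ₛ N (λ ν → F ν *ₛ g)
∑ₛ-*ₛ N F g .at n = begin
  ∑[ i < suc n ] (∑[ ν < N ] F ν i) * g (n ∸ i)
    ≡⟨ ∑<-cong (suc n) (λ i _ → ∑<-* N (g (n ∸ i)) (λ ν → F ν i)) ⟩
  ∑[ i < suc n ] ∑[ ν < N ] (F ν i * g (n ∸ i))
    ≡⟨ ∑<-comm (suc n) N (λ i ν → F ν i * g (n ∸ i)) ⟩
  ∑[ ν < N ] ∑[ i < suc n ] (F ν i * g (n ∸ i))      ∎
  where open ≡-Reasoning

*ₛ-∑ₛ : ∀ N f G → f *ₛ ∑ₛ N G ≈ ∑ₛ N (λ ν → f *ₛ G ν)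
*ₛ-∑ₛ N f G = begin
  f *ₛ ∑ₛ N G            ≈⟨ ×ₛ.comm f (∑ₛ N G) ⟩
  ∑ₛ N G *ₛ f            ≈⟨ ∑ₛ-*ₛ N G f ⟩
  ∑ₛ N (λ ν → G ν *ₛ f)  ≈⟨ (pointwise λ n → ∑<-cong N (λ ν _ → *ₛ-comm′ (G ν) f n)) ⟩
  ∑ₛ N (λ ν → f *ₛ G ν)  ∎
  where open ≈-Reasoning

-- The substitution f(rt), a ring homomorphism in f.
dilate : ℚ → Series → Series
dilate r f n = r ^ n * f n

^-split : ∀ r {i n} → i ℕ.≤ n → r ^ n ≡ r ^ i * r ^ (n ∸ i)
^-split r {i} {n} i≤n = trans (cong (r ^_) (sym (ℕ.m+[n∸m]≡n i≤n))) (^-homo-* r i (n ∸ i))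

dilate-*ₛ : ∀ r f g → dilate r (f *ₛ g) ≈ dilate r f *ₛ dilate r g
dilate-*ₛ r f g .at n = begin
  r ^ n * (f *ₛ g) n                       ≡⟨ *-∑< (suc n) (r ^ n) (λ i → f i * g (n ∸ i)) ⟩
  ∑[ i < suc n ] (r ^ n * (f i * g (n ∸ i)))  ≡⟨ ∑<-cong (suc n) (λ i i≤n → trans
      (cong (_* (f i * g (n ∸ i))) (^-split r (ℕ.s≤s⁻¹ i≤n)))
      (solve 4 (λ a b c d → a :* b :* (c :* d) := a :* c :* (b :* d)) refl (r ^ i) (r ^ (n ∸ i)) (f i) (g (n ∸ i)))) ⟩
  (dilate r f *ₛ dilate r g) n ∎
  where open ≡-Reasoning

dilate-cong : ∀ r {f g} → f ≈ g → dilate r f ≈ dilate r g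
dilate-cong r f≈g .at n = cong (r ^ n *_) (at f≈g n)

dilate-1ₛ : ∀ r → dilate r 1ₛ ≈ 1ₛ
dilate-1ₛ r .at zero    = refl
dilate-1ₛ r .at (suc n) = *-zeroʳ (r ^ suc n)

-- Exponential series and Bernoulli polynomials

-- The binomial theorem used for `exp-+` has its coefficients as iterated sums `n × q`; this turns
-- them into factors in ℚ.
×≡fromℕ-* : ∀ n q → n × q ≡ fromℕ n * q
×≡fromℕ-* zero    q = sym (*-zeroˡ q)
×≡fromℕ-* (suc n) q = begin
  q + n × q              ≡⟨ cong₂ _+_ (*-identityˡ q) (sym (×≡fromℕ-* n q)) ⟨
  1ℚ * q + fromℕ n * q   ≡⟨ *-distribʳ-+ q 1ℚ (fromℕ n) ⟨
  (1ℚ + fromℕ n) * q     ≡⟨ cong (_* q) (fromℕ-+ 1 n) ⟨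
  fromℕ (suc n) * q      ∎
  where open ≡-Reasoning

n!*1/!n≡1 : ∀ n → fromℕ (n !) * 1/! n ≡ 1ℚ
n!*1/!n≡1 n = n*1/n≡1 (n !) {{n ℕ.!≢0}}

n!≡nCk*k!*[n∸k]! : ∀ {n k} → k ℕ.≤ n →
  fromℕ (n !) ≡ fromℕ (n C k) * (fromℕ (k !) * fromℕ ((n ∸ k) !))
n!≡nCk*k!*[n∸k]! {n} {k} k≤n = begin
  fromℕ (n !)
    ≡⟨ cong fromℕ (trans (cong (ℕ._* (k ! ℕ.* (n ∸ k) !)) (nCk≡n!/k![n-k]! k≤n)) (m/n*n≡m (k![n∸k]!∣n! k≤n))) ⟨
  fromℕ ((n C k) ℕ.* (k ! ℕ.* (n ∸ k) !))               ≡⟨ fromℕ-* (n C k) _ ⟩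
  fromℕ (n C k) * fromℕ (k ! ℕ.* (n ∸ k) !)
    ≡⟨ cong (_*_ (fromℕ (n C k))) (fromℕ-* (k !) _) ⟩
  fromℕ (n C k) * (fromℕ (k !) * fromℕ ((n ∸ k) !))     ∎
  where
  open ≡-Reasoning
  instance _ = k ℕ.!* (n ∸ k) !≢0

-- Two factors 1, written as k! · 1/k! and (n-k)! · 1/(n-k)!, supply the factorials that complete
-- the binomial coefficient to n!, which then cancels against 1/n!.
nCk*1/!n : ∀ {n k} → k ℕ.≤ n → fromℕ (n C k) * 1/! n ≡ 1/! k * 1/! (n ∸ k)
nCk*1/!n {n} {k} k≤n = begin
  c * 1/! n
    ≡⟨ solve 2 (λ c z → c :* z := c :* (con 1ℚ :* con 1ℚ) :* z) refl c (1/! n) ⟩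
  c * (1ℚ * 1ℚ) * 1/! n
    ≡⟨ cong₂ (λ x y → c * (x * y) * 1/! n) (n!*1/!n≡1 k) (n!*1/!n≡1 (n ∸ k)) ⟨
  c * ((a * 1/! k) * (b * 1/! (n ∸ k))) * 1/! n
    ≡⟨ solve 6 (λ a b c x y z → c :* ((a :* x) :* (b :* y)) :* z := c :* (a :* b) :* z :* (x :* y))
         refl a b c (1/! k) (1/! (n ∸ k)) (1/! n) ⟩
  c * (a * b) * 1/! n * (1/! k * 1/! (n ∸ k))
    ≡⟨ cong (λ x → x * 1/! n * (1/! k * 1/! (n ∸ k))) (n!≡nCk*k!*[n∸k]! k≤n) ⟨
  fromℕ (n !) * 1/! n * (1/! k * 1/! (n ∸ k))
    ≡⟨ cong (_* (1/! k * 1/! (n ∸ k))) (n!*1/!n≡1 n) ⟩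
  1ℚ * (1/! k * 1/! (n ∸ k))
    ≡⟨ *-identityˡ (1/! k * 1/! (n ∸ k)) ⟩
  1/! k * 1/! (n ∸ k) ∎
  where
  open ≡-Reasoning
  a = fromℕ (k !)
  b = fromℕ ((n ∸ k) !)
  c = fromℕ (n C k)

egf-*ₛ : ∀ f g n →
  egf (f *ₛ g) n ≡ ∑[ j < suc n ] (fromℕ (n C j) * egf f j * egf g (n ∸ j))
egf-*ₛ f g n = trans (*-∑< (suc n) (fromℕ (n !)) (λ j → f j * g (n ∸ j)))
  (∑<-cong (suc n) λ j j≤n → trans
    (cong (_* (f j * g (n ∸ j))) (n!≡nCk*k!*[n∸k]! (ℕ.s≤s⁻¹ j≤n)))
    (solve 5 (λ c a b f g → c :* (a :* b) :* (f :* g) := c :* (a :* f) :* (b :* g)) refl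
      (fromℕ (n C j)) (fromℕ (j !)) (fromℕ ((n ∸ j) !)) (f j) (g (n ∸ j))))

exp-+ : ∀ x y → exp (x + y) ≈ exp x *ₛ exp y
exp-+ x y .at n = begin
  (x + y) ^ n * 1/! n
    ≡⟨ cong (_* 1/! n) (Binomial.theorem n x y) ⟩
  (∑[ i < suc n ] ((n C i) × (x ^ i * y ^ (n ∸ i)))) * 1/! n
    ≡⟨ ∑<-* (suc n) (1/! n) (λ i → (n C i) × (x ^ i * y ^ (n ∸ i))) ⟩
  ∑[ i < suc n ] ((n C i) × (x ^ i * y ^ (n ∸ i)) * 1/! n)
    ≡⟨ ∑<-cong (suc n) (λ i i≤n → term i (ℕ.s≤s⁻¹ i≤n)) ⟩
  (exp x *ₛ exp y) n ∎
  where
  open ≡-Reasoning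
  term : ∀ i → i ℕ.≤ n → (n C i) × (x ^ i * y ^ (n ∸ i)) * 1/! n ≡ exp x i * exp y (n ∸ i)
  term i i≤n = begin
    (n C i) × (x ^ i * y ^ (n ∸ i)) * 1/! n
      ≡⟨ cong (_* 1/! n) (×≡fromℕ-* (n C i) (x ^ i * y ^ (n ∸ i))) ⟩
    fromℕ (n C i) * (x ^ i * y ^ (n ∸ i)) * 1/! n
      ≡⟨ solve 4 (λ c a b z → c :* (a :* b) :* z := a :* b :* (c :* z))
           refl (fromℕ (n C i)) (x ^ i) (y ^ (n ∸ i)) (1/! n) ⟩
    x ^ i * y ^ (n ∸ i) * (fromℕ (n C i) * 1/! n)
      ≡⟨ cong (_*_ (x ^ i * y ^ (n ∸ i))) (nCk*1/!n i≤n) ⟩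
    x ^ i * y ^ (n ∸ i) * (1/! i * 1/! (n ∸ i))
      ≡⟨ solve 4 (λ a b c d → a :* b :* (c :* d) := a :* c :* (b :* d))
           refl (x ^ i) (y ^ (n ∸ i)) (1/! i) (1/! (n ∸ i)) ⟩
    exp x i * exp y (n ∸ i) ∎

dilate-exp : ∀ r x → dilate r (exp x) ≈ exp (r * x)
dilate-exp r x .at n = trans (sym (*-assoc (r ^ n) (x ^ n) (1/! n)))
  (cong (_* 1/! n) (sym (^-distrib-* r x n)))

-- The geometric sum and Raabe's formula for Bernoulli polynomials

expm1 : ℚ → Series
expm1 x = exp x -ₛ 1ₛ

tail : Series → Series
tail f n = f (suc n)

-- Multiplication by e^(rt) carries each exponential of the sum to the next one, so multiplication
-- by e^(rt) - 1 telescopes.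
∑-exp-*-expm1 : ∀ h x r →
  ∑ₛ h (λ ν → exp (x + fromℕ ν * r)) *ₛ expm1 r ≈ exp (x + fromℕ h * r) -ₛ exp x
∑-exp-*-expm1 h x r .at n = begin
  (∑ₛ h F *ₛ expm1 r) n
    ≡⟨ at (*ₛ-distribˡ--ₛ (∑ₛ h F) (exp r) 1ₛ) n ⟩
  (∑ₛ h F *ₛ exp r) n - (∑ₛ h F *ₛ 1ₛ) n
    ≡⟨ cong₂ _-_ (at shift n) (at (×ₛ.identityʳ (∑ₛ h F)) n) ⟩
  s′ - s
    -- The initial exponential is added and subtracted: in the form `F 0` it completes the shifted
    -- sum so that `∑<-suc` applies.
    ≡⟨ solve 3 (λ a b c → a :- b := a :+ c :- b :- c) refl s′ s (exp x n) ⟩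
  s′ + exp x n - s - exp x n
    ≡⟨ cong (λ a → s′ + a - s - exp x n) (cong (λ y → exp y n) (solve 2 (λ x r → x := x :+ con 0ℚ :* r) refl x r)) ⟩
  s′ + F 0 n - s - exp x n
    ≡⟨ cong (λ a → a - s - exp x n) (∑<-suc h (λ ν → F ν n)) ⟩
  s + F h n - s - exp x n
    ≡⟨ solve 3 (λ a b c → a :+ b :- a :- c := b :- c) refl s (F h n) (exp x n) ⟩
  F h n - exp x n ∎
  where
  open ≡-Reasoning
  F : ℕ → Series
  F ν = exp (x + fromℕ ν * r)
  s  = ∑< h (λ ν → F ν n)
  s′ = ∑< h (λ ν → F (suc ν) n)
  step : ∀ ν → F ν *ₛ exp r ≈ F (suc ν)
  step ν .at k = trans (sym (at (exp-+ (x + fromℕ ν * r) r) k)) (cong (λ y → exp y k) (trans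
    (solve 3 (λ x n r → x :+ n :* r :+ r := x :+ (con 1ℚ :+ n) :* r) refl x (fromℕ ν) r)
    (cong (λ a → x + a * r) (sym (fromℕ-+ 1 ν)))))
  shift : ∑ₛ h F *ₛ exp r ≈ ∑ₛ h (λ ν → F (suc ν))
  shift .at k = trans (at (∑ₛ-*ₛ h F (exp r)) k) (∑<-cong h (λ ν _ → at (step ν) k))

-- Division of f = g h by t: as h has no constant term, the factor t can be taken from h alone.
tail-*ₛ : ∀ {f} g h → h 0 ≡ 0ℚ → f ≈ g *ₛ h → tail f ≈ g *ₛ tail h
tail-*ₛ {f} g h h₀≡0 f≈g*h .at n = begin
  f (suc n)                            ≡⟨ at f≈g*h (suc n) ⟩
  (g *ₛ h) (suc n)                     ≡⟨ *ₛ-suc g h n ⟩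
  (g *ₛ tail h) n + g (suc n) * h 0    ≡⟨ cong (λ a → (g *ₛ tail h) n + g (suc n) * a) h₀≡0 ⟩
  (g *ₛ tail h) n + g (suc n) * 0ℚ     ≡⟨ cong (_+_ ((g *ₛ tail h) n)) (*-zeroʳ (g (suc n))) ⟩
  (g *ₛ tail h) n + 0ℚ                 ≡⟨ +-identityʳ ((g *ₛ tail h) n) ⟩
  (g *ₛ tail h) n                      ∎
  where open ≡-Reasoning

-- With E(u) = (e^u - 1)/u, this is (e^(rt) - 1)/t = r E(rt).
tail-expm1 : ∀ r → tail (expm1 r) ≈ r ·ₛ dilate r (tail (expm1 1ℚ))
tail-expm1 r .at n = begin
  r * r ^ n * 1/! (suc n) - 0ℚ
    ≡⟨ solve 3 (λ r p z → r :* p :* z :- con 0ℚ := r :* (p :* (con 1ℚ :* z :- con 0ℚ)))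
         refl r (r ^ n) (1/! (suc n)) ⟩
  r * (r ^ n * (1ℚ * 1/! (suc n) - 0ℚ))
    ≡⟨ cong (λ a → r * (r ^ n * (a * 1/! (suc n) - 0ℚ))) (1^n≡1 (suc n)) ⟨
  r * (r ^ n * (1ℚ ^ suc n * 1/! (suc n) - 0ℚ)) ∎
  where open ≡-Reasoning

t/[eᵗ-1] : Series
t/[eᵗ-1] = t /ₛ expm1 1ℚ

t/[eᵗ-1]-inverse : t/[eᵗ-1] *ₛ tail (expm1 1ℚ) ≈ 1ₛ
t/[eᵗ-1]-inverse .at n = trans (quotient-*ₛ (tail t) (tail (expm1 1ℚ)) n) (tail-t n)
  where
  tail-t : ∀ n → t (suc n) ≡ 1ₛ n
  tail-t zero    = refl
  tail-t (suc n) = refl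

-- The quotient q satisfies q E = `tail f`, and t/(e^t - 1) is the inverse of E; so q = q E · t/(e^t
-- - 1). This exposes the Bernoulli factor inside the poly-Bernoulli generating function.
/ₛ-expm1 : ∀ f → f /ₛ expm1 1ℚ ≈ t/[eᵗ-1] *ₛ tail f
/ₛ-expm1 f = begin
  q                            ≈⟨ ×ₛ.identityʳ q ⟨
  q *ₛ 1ₛ                      ≈⟨ *ₛ-congˡ q t/[eᵗ-1]-inverse ⟨
  q *ₛ (t/[eᵗ-1] *ₛ E)         ≈⟨ x∙yz≈y∙xz q t/[eᵗ-1] E ⟩
  t/[eᵗ-1] *ₛ (q *ₛ E)         ≈⟨ *ₛ-congˡ t/[eᵗ-1] (pointwise (quotient-*ₛ (tail f) E)) ⟩
  t/[eᵗ-1] *ₛ tail f           ∎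
  where
  open ≈-Reasoning
  E = tail (expm1 1ℚ)
  q = f /ₛ expm1 1ℚ

-- `egf (bernoulli x) n` is `B n x` by definition.
bernoulli : ℚ → Series
bernoulli x = t/[eᵗ-1] *ₛ exp x

module _ (h : ℕ) .{{_ : NonZero h}} where
  private
    r = + 1 / h

  -- With r = 1/h, the h steps of the geometric sum lead exactly from x to x + 1.
  exp-*-expm1 : ∀ x →
    exp x *ₛ expm1 1ℚ ≈ ∑ₛ h (λ ν → exp (x + fromℕ ν * r)) *ₛ expm1 r
  exp-*-expm1 x .at n = begin
    (exp x *ₛ expm1 1ℚ) n                    ≡⟨ at (*ₛ-distribˡ--ₛ (exp x) (exp 1ℚ) 1ₛ) n ⟩
    (exp x *ₛ exp 1ℚ) n - (exp x *ₛ 1ₛ) n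
      ≡⟨ cong₂ _-_ (sym (at (exp-+ x 1ℚ) n)) (at (×ₛ.identityʳ (exp x)) n) ⟩
    exp (x + 1ℚ) n - exp x n
      ≡⟨ cong (λ a → exp (x + a) n - exp x n) (n*1/n≡1 h) ⟨
    exp (x + fromℕ h * r) n - exp x n        ≡⟨ at (∑-exp-*-expm1 h x r) n ⟨
    (∑ₛ h (λ ν → exp (x + fromℕ ν * r)) *ₛ expm1 r) n ∎
    where open ≡-Reasoning

  -- Raabe's formula as an identity of generating functions. Since β E = 1, a factor β E may be
  -- inserted after e^(xt); `geometric` turns e^(xt) E into G · r E(rt), and E(rt) cancels against
  -- the dilated β(rt). What remains is r β G, a sum of Bernoulli generating functions.
  dilate-bernoulli : ∀ x →
    dilate r (bernoulli (fromℕ h * x)) ≈ r ·ₛ ∑ₛ h (λ ν → bernoulli (x + fromℕ ν * r))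
  dilate-bernoulli x = begin
    dilate r (β *ₛ exp (fromℕ h * x))        ≈⟨ dilate-*ₛ r β (exp (fromℕ h * x)) ⟩
    Dβ *ₛ dilate r (exp (fromℕ h * x))
      ≈⟨ *ₛ-congˡ Dβ (×ₛ.trans (dilate-exp r (fromℕ h * x)) (exp-cong r[hx]≡x)) ⟩
    Dβ *ₛ exp x                              ≈⟨ *ₛ-congˡ Dβ (×ₛ.identityʳ (exp x)) ⟨
    Dβ *ₛ (exp x *ₛ 1ₛ)
      ≈⟨ *ₛ-congˡ Dβ (*ₛ-congˡ (exp x) t/[eᵗ-1]-inverse) ⟨
    Dβ *ₛ (exp x *ₛ (β *ₛ E))                ≈⟨ *ₛ-congˡ Dβ (x∙yz≈y∙xz (exp x) β E) ⟩
    Dβ *ₛ (β *ₛ (exp x *ₛ E))                ≈⟨ *ₛ-congˡ Dβ (*ₛ-congˡ β geometric) ⟩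
    Dβ *ₛ (β *ₛ (G *ₛ r ·ₛ dilate r E))      ≈⟨ *ₛ-congˡ Dβ (×ₛ.assoc β G (r ·ₛ dilate r E)) ⟨
    Dβ *ₛ ((β *ₛ G) *ₛ r ·ₛ dilate r E)      ≈⟨ x∙yz≈y∙xz Dβ (β *ₛ G) (r ·ₛ dilate r E) ⟩
    (β *ₛ G) *ₛ (Dβ *ₛ r ·ₛ dilate r E)      ≈⟨ *ₛ-congˡ (β *ₛ G) (*ₛ-·ₛ r Dβ (dilate r E)) ⟩
    (β *ₛ G) *ₛ r ·ₛ (Dβ *ₛ dilate r E)      ≈⟨ *ₛ-congˡ (β *ₛ G) (·ₛ-cong r inverse) ⟩
    (β *ₛ G) *ₛ r ·ₛ 1ₛ                      ≈⟨ *ₛ-·ₛ r (β *ₛ G) 1ₛ ⟩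
    r ·ₛ ((β *ₛ G) *ₛ 1ₛ)                    ≈⟨ ·ₛ-cong r (×ₛ.identityʳ (β *ₛ G)) ⟩
    r ·ₛ (β *ₛ G)
      ≈⟨ ·ₛ-cong r (*ₛ-∑ₛ h β (λ ν → exp (x + fromℕ ν * r))) ⟩
    r ·ₛ ∑ₛ h (λ ν → bernoulli (x + fromℕ ν * r)) ∎
    where
    open ≈-Reasoning
    β Dβ E G : Series
    β  = t/[eᵗ-1]
    Dβ = dilate r β
    E  = tail (expm1 1ℚ)
    G  = ∑ₛ h (λ ν → exp (x + fromℕ ν * r))

    exp-cong : ∀ {x y} → x ≡ y → exp x ≈ exp y
    exp-cong refl = ×ₛ.refl

    r[hx]≡x : r * (fromℕ h * x) ≡ x
    r[hx]≡x = trans (solve 3 (λ r h x → r :* (h :* x) := h :* r :* x) refl r (fromℕ h) x)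
      (trans (cong (_* x) (n*1/n≡1 h)) (*-identityˡ x))

    inverse : Dβ *ₛ dilate r E ≈ 1ₛ
    inverse = begin
      Dβ *ₛ dilate r E     ≈⟨ dilate-*ₛ r β E ⟨
      dilate r (β *ₛ E)    ≈⟨ dilate-cong r t/[eᵗ-1]-inverse ⟩
      dilate r 1ₛ          ≈⟨ dilate-1ₛ r ⟩
      1ₛ                   ∎

    geometric : exp x *ₛ E ≈ G *ₛ r ·ₛ dilate r E
    geometric = begin
      -- Both sides of `exp-*-expm1` are divided by t, since `expm1` has no constant term.
      exp x *ₛ E                     ≈⟨ tail-*ₛ (exp x) (expm1 1ℚ) refl ×ₛ.refl ⟨
      tail (exp x *ₛ expm1 1ℚ)       ≈⟨ tail-*ₛ G (expm1 r) refl (exp-*-expm1 x) ⟩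
      G *ₛ tail (expm1 r)            ≈⟨ *ₛ-congˡ G (tail-expm1 r) ⟩
      G *ₛ r ·ₛ dilate r E           ∎

  B-multiplication : ∀ n x → r ^ n * B n (fromℕ h * x) ≡ r * (∑[ ν < h ] B n (x + fromℕ ν * r))
  B-multiplication n x = begin
    r ^ n * (c * bernoulli (fromℕ h * x) n)
      ≡⟨ solve 3 (λ a b c → a :* (b :* c) := b :* (a :* c))
           refl (r ^ n) c (bernoulli (fromℕ h * x) n) ⟩
    c * dilate r (bernoulli (fromℕ h * x)) n
      ≡⟨ cong (_*_ c) (at (dilate-bernoulli x) n) ⟩
    c * (r * s)
      ≡⟨ solve 3 (λ a b c → a :* (b :* c) := b :* (a :* c)) refl c r s ⟩
    r * (c * s)
      ≡⟨ cong (_*_ r) (*-∑< h c (λ ν → bernoulli (x + fromℕ ν * r) n)) ⟩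
    r * (∑[ ν < h ] B n (x + fromℕ ν * r)) ∎
    where
    open ≡-Reasoning
    c = fromℕ (n !)
    s = ∑[ ν < h ] bernoulli (x + fromℕ ν * r) n

-- Type 2 poly-Bernoulli polynomials

-- The exponential coefficients A_n of Ei_k(log(1+t))/t, with the factor t/(e^t - 1) split off; they
-- are not the values of the poly-Bernoulli polynomials at x = 0.
polyBernoulliNumber : ℤ → ℕ → ℚ
polyBernoulliNumber k n =
  ∑[1≤ l ≤ suc n ] (S₁ (suc n) l * ((+ 1 / suc n) * l ^ℤ (ℤ.- (k ℤ.- + 1))))

^ℤ-suc : ∀ n .{{_ : NonZero n}} z → n ^ℤ (z ℤ.+ + 1) ≡ fromℕ n * n ^ℤ z
^ℤ-suc n (+ a) = trans (cong (λ b → fromℕ (n ℕ.^ b)) (ℕ.+-comm a 1)) (fromℕ-* n (n ℕ.^ a))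
-- Exponent -1 is the crossing point: its successor is the nonnegative exponent 0, where `_^ℤ_` is
-- no longer a reciprocal.
^ℤ-suc n -[1+ zero ] = sym (begin
  fromℕ n * (+ 1 / (n ℕ.* 1))
    ≡⟨ cong (_*_ (fromℕ n)) (/-cong {+ 1} {n ℕ.* 1} {+ 1} {n} refl (ℕ.*-identityʳ n)) ⟩
  fromℕ n * (+ 1 / n)          ≡⟨ n*1/n≡1 n ⟩
  1ℚ                           ∎)
  where
  open ≡-Reasoning
  instance _ = ℕ.m^n≢0 n 1
^ℤ-suc n -[1+ suc a ] = sym (begin
  fromℕ n * (+ 1 / (n ℕ.* N))                              ≡⟨ *-identityʳ _ ⟨
  fromℕ n * (+ 1 / (n ℕ.* N)) * 1ℚ
    ≡⟨ cong (_*_ (fromℕ n * (+ 1 / (n ℕ.* N)))) (n*1/n≡1 N) ⟨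
  fromℕ n * (+ 1 / (n ℕ.* N)) * (fromℕ N * (+ 1 / N))
    ≡⟨ solve 4 (λ a b c d → a :* b :* (c :* d) := a :* c :* b :* d)
         refl (fromℕ n) (+ 1 / (n ℕ.* N)) (fromℕ N) (+ 1 / N) ⟩
  fromℕ n * fromℕ N * (+ 1 / (n ℕ.* N)) * (+ 1 / N)
    ≡⟨ cong (λ b → b * (+ 1 / (n ℕ.* N)) * (+ 1 / N)) (fromℕ-* n N) ⟨
  fromℕ (n ℕ.* N) * (+ 1 / (n ℕ.* N)) * (+ 1 / N)
    ≡⟨ cong (_* (+ 1 / N)) (n*1/n≡1 (n ℕ.* N)) ⟩
  1ℚ * (+ 1 / N)                                           ≡⟨ *-identityˡ (+ 1 / N) ⟩
  + 1 / N                                                  ∎)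
  where
  open ≡-Reasoning
  N = n ℕ.^ suc a
  instance _ = ℕ.m^n≢0 n (suc a)
  instance _ = ℕ.m^n≢0 n (suc (suc a))

-‿pred : ∀ k → ℤ.- (k ℤ.- + 1) ≡ ℤ.- k ℤ.+ + 1
-‿pred k = ℤ.neg-distrib-+ k (ℤ.- (+ 1))

-- Three shifts by one meet here. Dropping a factor t makes n! out of (n+1)!, hence the 1/(n+1).
-- Writing 1/(l-1)! as l · 1/l! provides the 1/l! of the Stirling numbers, and the remaining l
-- raises l^(-k) to l^(1-k).
egf-Ei∘log : ∀ k n → egf (tail (Ei k ∘ₛ log[1+t])) n ≡ polyBernoulliNumber k n
egf-Ei∘log k n = begin
  fromℕ (n !) * (0ℚ * (log[1+t] ^ₛ 0) (suc n) + s)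
    -- `Ei k` has no constant term, so the sum over powers of the logarithm starts at exponent 1.
    ≡⟨ solve 3 (λ a b c → a :* (con 0ℚ :* b :+ c) := a :* c)
         refl (fromℕ (n !)) ((log[1+t] ^ₛ 0) (suc n)) s ⟩
  fromℕ (n !) * s
    ≡⟨ *-∑< (suc n) (fromℕ (n !)) (λ l → Ei k (suc l) * L l) ⟩
  ∑[ l < suc n ] (fromℕ (n !) * (Ei k (suc l) * L l))  ≡⟨ ∑<-cong (suc n) (λ l _ → term l) ⟩
  polyBernoulliNumber k n                           ∎
  where
  open ≡-Reasoning
  L : ℕ → ℚ
  L l = (log[1+t] ^ₛ suc l) (suc n)
  s = ∑[ l < suc n ] Ei k (suc l) * L l
  r = + 1 / suc n
  1/!-suc : ∀ l → 1/! l ≡ fromℕ (suc l) * 1/! (suc l)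
  1/!-suc l = begin
    1/! l                                                     ≡⟨ *-identityʳ (1/! l) ⟨
    1/! l * 1ℚ
      ≡⟨ cong (_*_ (1/! l)) (n!*1/!n≡1 (suc l)) ⟨
    1/! l * (fromℕ (suc l ℕ.* l !) * 1/! (suc l))
      ≡⟨ cong (λ a → 1/! l * (a * 1/! (suc l))) (fromℕ-* (suc l) (l !)) ⟩
    1/! l * (fromℕ (suc l) * fromℕ (l !) * 1/! (suc l))
      ≡⟨ solve 4 (λ a b c d → a :* (b :* c :* d) := b :* d :* (c :* a))
           refl (1/! l) (fromℕ (suc l)) (fromℕ (l !)) (1/! (suc l)) ⟩
    fromℕ (suc l) * 1/! (suc l) * (fromℕ (l !) * 1/! l)
      ≡⟨ cong (_*_ (fromℕ (suc l) * 1/! (suc l))) (n!*1/!n≡1 l) ⟩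
    fromℕ (suc l) * 1/! (suc l) * 1ℚ                          ≡⟨ *-identityʳ _ ⟩
    fromℕ (suc l) * 1/! (suc l)                               ∎
  term : ∀ l → fromℕ (n !) * (Ei k (suc l) * L l)
    ≡ S₁ (suc n) (suc l) * (r * suc l ^ℤ (ℤ.- (k ℤ.- + 1)))
  term l = begin
    fromℕ (n !) * (e * 1/! l * L l)
      ≡⟨ cong (λ a → fromℕ (n !) * (e * a * L l)) (1/!-suc l) ⟩
    fromℕ (n !) * (e * (fromℕ (suc l) * 1/! (suc l)) * L l)
      -- The leading `1ℚ` is a placeholder for (n+1) · 1/(n+1), which completes n! to (n+1)!.
      ≡⟨ solve 5 (λ a b c d f → a :* (b :* (c :* d) :* f) := con 1ℚ :* a :* (f :* d) :* (c :* b))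
           refl (fromℕ (n !)) e (fromℕ (suc l)) (1/! (suc l)) (L l) ⟩
    1ℚ * fromℕ (n !) * (L l * 1/! (suc l)) * (fromℕ (suc l) * e)
      ≡⟨ cong (λ a → a * fromℕ (n !) * (L l * 1/! (suc l)) * (fromℕ (suc l) * e)) (n*1/n≡1 (suc n)) ⟨
    fromℕ (suc n) * r * fromℕ (n !) * (L l * 1/! (suc l)) * (fromℕ (suc l) * e)
      ≡⟨ solve 5 (λ a b c d f → a :* b :* c :* d :* f := a :* c :* d :* (b :* f))
           refl (fromℕ (suc n)) r (fromℕ (n !)) (L l * 1/! (suc l)) (fromℕ (suc l) * e) ⟩
    fromℕ (suc n) * fromℕ (n !) * (L l * 1/! (suc l)) * (r * (fromℕ (suc l) * e))
      ≡⟨ cong₂ (λ a b → a * (L l * 1/! (suc l)) * (r * b)) (sym (fromℕ-* (suc n) (n !))) (sym (^ℤ-suc (suc l) (ℤ.- k))) ⟩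
    S₁ (suc n) (suc l) * (r * suc l ^ℤ (ℤ.- k ℤ.+ + 1))
      ≡⟨ cong (λ z → S₁ (suc n) (suc l) * (r * suc l ^ℤ z)) (-‿pred k) ⟨
    S₁ (suc n) (suc l) * (r * suc l ^ℤ (ℤ.- (k ℤ.- + 1))) ∎
    where e = suc l ^ℤ (ℤ.- k)

polyB-expansion : ∀ k n x →
  polyB k n x ≡ ∑[ j < suc n ] (fromℕ (n C j) * B j x * polyBernoulliNumber k (n ∸ j))
polyB-expansion k n x = begin
  polyB k n x                            ≡⟨ cong (_*_ (fromℕ (n !))) (at factor n) ⟩
  egf (bernoulli x *ₛ tail F) n          ≡⟨ egf-*ₛ (bernoulli x) (tail F) n ⟩
  ∑[ j < suc n ] (fromℕ (n C j) * B j x * egf (tail F) (n ∸ j))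
    ≡⟨ ∑<-cong (suc n) (λ j _ → cong (_*_ (fromℕ (n C j) * B j x)) (egf-Ei∘log k (n ∸ j))) ⟩
  ∑[ j < suc n ] (fromℕ (n C j) * B j x * polyBernoulliNumber k (n ∸ j)) ∎
  where
  open ≡-Reasoning
  F = Ei k ∘ₛ log[1+t]
  factor : F /ₛ expm1 1ℚ *ₛ exp x ≈ bernoulli x *ₛ tail F
  factor = ×ₛ.trans (*ₛ-cong {f = F /ₛ expm1 1ℚ} {g = exp x} (/ₛ-expm1 F) ×ₛ.refl)
    (xy∙z≈xz∙y t/[eᵗ-1] (tail F) (exp x))

-- Periodic Bernoulli functions

module _ (h : ℕ) .{{_ : NonZero h}} (f : ℚ → ℚ) (periodic : ∀ x → f (x + 1ℚ) ≡ f x) where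
  private
    r = + 1 / h
    T : ℚ → ℚ
    T x = ∑[ ν < h ] f (x + fromℕ ν * r)

  -- A shift by 1/h loses the translate at x and gains one at x + 1, where f has the same value.
  -- Adding f(x) to both sides makes this an instance of `∑<-suc`.
  ∑-translates-shift : ∀ x → T (x + r) ≡ T x
  ∑-translates-shift x = +-cancelʳ (f x₀) (T (x + r)) (T x) (begin
    T (x + r) + f x₀               ≡⟨ cong (_+ f x₀) (∑<-cong h (λ ν _ → cong f (step ν))) ⟩
    ∑< h (λ ν → F (suc ν)) + F 0   ≡⟨ ∑<-suc h F ⟩
    T x + F h                      ≡⟨ cong (_+_ (T x)) last ⟩
    T x + f x₀                     ∎)
    where
    open ≡-Reasoning
    F : ℕ → ℚ
    F ν = f (x + fromℕ ν * r)
    x₀ = x + fromℕ 0 * r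
    +-cancelʳ : ∀ a b c → b + a ≡ c + a → b ≡ c
    +-cancelʳ a b c eq = trans (solve 2 (λ a b → b := b :+ a :- a) refl a b)
      (trans (cong (_- a) eq) (solve 2 (λ a b → b :+ a :- a := b) refl a c))
    step : ∀ ν → x + r + fromℕ ν * r ≡ x + fromℕ (suc ν) * r
    step ν = trans
      (solve 3 (λ x n r → x :+ r :+ n :* r := x :+ (con 1ℚ :+ n) :* r) refl x (fromℕ ν) r)
      (cong (λ a → x + a * r) (sym (fromℕ-+ 1 ν)))
    last : F h ≡ f x₀
    last = trans (cong (λ a → f (x + a)) (n*1/n≡1 h)) (trans (periodic x)
      (cong f (solve 2 (λ x r → x := x :+ con 0ℚ :* r) refl x r)))

  ∑-translates-shiftℕ : ∀ q x → T (x + fromℕ q * r) ≡ T x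
  ∑-translates-shiftℕ zero    x = cong T (solve 2 (λ x r → x :+ con 0ℚ :* r := x) refl x r)
  ∑-translates-shiftℕ (suc q) x = begin
    T (x + fromℕ (suc q) * r)        ≡⟨ cong (λ a → T (x + a * r)) (fromℕ-+ 1 q) ⟩
    T (x + (1ℚ + fromℕ q) * r)
      ≡⟨ cong T (solve 3 (λ x n r → x :+ (con 1ℚ :+ n) :* r := x :+ n :* r :+ r)
           refl x (fromℕ q) r) ⟩
    T (x + fromℕ q * r + r)          ≡⟨ ∑-translates-shift (x + fromℕ q * r) ⟩
    T (x + fromℕ q * r)              ≡⟨ ∑-translates-shiftℕ q x ⟩
    T x                              ∎
    where open ≡-Reasoning

  ∑-translates-shiftℤ : ∀ z x → T (x + fromℤ z * r) ≡ T x
  ∑-translates-shiftℤ (+ q)      x = ∑-translates-shiftℕ q x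
  ∑-translates-shiftℤ z@(-[1+ q ]) x = begin
    T (x + fromℤ z * r)
      -- A negative shift is undone by the opposite natural one, starting from the shifted point.
      ≡⟨ ∑-translates-shiftℕ (suc q) (x + fromℤ z * r) ⟨
    T (x + fromℤ z * r + fromℕ (suc q) * r)
      ≡⟨ cong T (solve 4 (λ x a b r → x :+ a :* r :+ b :* r := x :+ (a :+ b) :* r)
           refl x (fromℤ z) (fromℕ (suc q)) r) ⟩
    T (x + (fromℤ z + fromℕ (suc q)) * r)
      ≡⟨ cong (λ a → T (x + a * r)) (trans (sym (fromℤ-+ z (+ suc q))) (cong fromℤ (ℤ.+-inverseˡ (+ suc q)))) ⟩
    T (x + 0ℚ * r)
      ≡⟨ cong T (solve 2 (λ x r → x :+ con 0ℚ :* r := x) refl x r) ⟩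
    T x                                            ∎
    where open ≡-Reasoning

-- From x + ν < ν + 1 ≤ h, divided by h.
[x+ν]/h<1 : ∀ {x ν h} .{{_ : NonZero h}} → x < 1ℚ → ν ℕ.< h →
  x * (+ 1 / h) + fromℕ ν * (+ 1 / h) < 1ℚ
[x+ν]/h<1 {x} {ν} {h} x<1 ν<h = subst₂ _<_ (*-distribʳ-+ r x (fromℕ ν)) (n*1/n≡1 h)
  (*-monoˡ-<-pos r (<-≤-trans
    (subst (x + fromℕ ν <_) (sym (fromℕ-+ 1 ν)) (+-monoˡ-< (fromℕ ν) x<1))
    (fromℕ-mono ν<h)))
  where
  r = + 1 / h
  instance _ = normalize-pos 1 h
  fromℕ-mono : ∀ {a b} → a ℕ.≤ b → fromℕ a ≤ fromℕ b
  fromℕ-mono {a} {b} a≤b = subst₂ _≤_ (+-identityʳ (fromℕ a))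
    (trans (sym (fromℕ-+ a (b ∸ a))) (cong fromℕ (ℕ.m+[n∸m]≡n a≤b)))
    (+-monoʳ-≤ (fromℕ a) (nonNegative⁻¹ (fromℕ (b ∸ a)) {{normalize-nonNeg (b ∸ a) 1}}))

-- With y = ⟨hx⟩ and q the floor of hx, x = y/h + q/h. The point y/h is the representative of x in
-- [0, 1/h) modulo 1/h, and the left-hand side depends on y only.
B̄-multiplication : ∀ h .{{_ : NonZero h}} n x →
  (+ 1 / h) ^ n * B̄ n (fromℕ h * x) ≡ (+ 1 / h) * (∑[ ν < h ] B̄ n (x + fromℕ ν * (+ 1 / h)))
B̄-multiplication h n x = begin
  r ^ n * B n y                                ≡⟨ cong (λ a → r ^ n * B n a) (h*[a*r]≡a y) ⟨
  r ^ n * B n (fromℕ h * (y * r))              ≡⟨ B-multiplication h n (y * r) ⟩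
  r * (∑[ ν < h ] B n (y * r + fromℕ ν * r))
    -- All translates y/h + ν/h with ν < h lie in [0, 1), so `B n` and `B̄ n` agree on them.
    ≡⟨ cong (_*_ r) (∑<-cong h (λ ν ν<h →
         cong (B n) (sym (⟨⟩-small _ (0≤ ν) ([x+ν]/h<1 (⟨⟩<1 (fromℕ h * x)) ν<h))))) ⟩
  r * T (y * r)
    -- Moving the base point from y/h to x is a shift by q/h, with q an integer of either sign.
    ≡⟨ cong (_*_ r) (∑-translates-shiftℤ h (B̄ n) (λ z → cong (B n) (⟨⟩-periodic z)) q (y * r)) ⟨
  r * T (y * r + fromℤ q * r)
    ≡⟨ cong (λ a → r * T a) y*r+q*r≡x ⟩
  r * T x                                      ∎
  where
  open ≡-Reasoning
  r = + 1 / h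
  y = ⟨ fromℕ h * x ⟩
  q = floor (fromℕ h * x)
  T : ℚ → ℚ
  T z = ∑[ ν < h ] B̄ n (z + fromℕ ν * r)
  h*[a*r]≡a : ∀ a → fromℕ h * (a * r) ≡ a
  h*[a*r]≡a a = trans (solve 3 (λ h a r → h :* (a :* r) := h :* r :* a) refl (fromℕ h) a r)
    (trans (cong (_* a) (n*1/n≡1 h)) (*-identityˡ a))
  y*r+q*r≡x : y * r + fromℤ q * r ≡ x
  y*r+q*r≡x = begin
    y * r + fromℤ q * r   ≡⟨ *-distribʳ-+ r y (fromℤ q) ⟨
    (y + fromℤ q) * r     ≡⟨ cong (_* r) (⟨⟩+floor (fromℕ h * x)) ⟩
    fromℕ h * x * r       ≡⟨ *-assoc (fromℕ h) x r ⟩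
    fromℕ h * (x * r)     ≡⟨ h*[a*r]≡a x ⟩
    x                     ∎
  0≤ : ∀ ν → 0ℚ ≤ y * r + fromℕ ν * r
  0≤ ν = nonNegative⁻¹ (y * r + fromℕ ν * r)
    {{nonNeg+nonNeg⇒nonNeg (y * r) 
        {{nonNeg*nonNeg⇒nonNeg y {{nonNegative (0≤⟨⟩ (fromℕ h * x))}} r {{normalize-nonNeg 1 h}}}}
      (fromℕ ν * r)
        {{nonNeg*nonNeg⇒nonNeg (fromℕ ν) {{normalize-nonNeg ν 1}} r {{normalize-nonNeg 1 h}}}}}}

-- Raabe's formula at x = μ/m, solved for the single value by multiplying with h^j. Its points ν/h +
-- μ/m are symmetric in the pairs (h, ν) and (m, μ), which lets the two Dedekind sums be merged.
B̄-distribution : ∀ (m h : ℕ) .{{_ : NonZero m}} .{{_ : NonZero h}} j μ →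
  B̄ j (+ (h ℕ.* μ) / m)
    ≡ fromℕ h ^ j * (+ 1 / h) * (∑[ ν < h ] B̄ j ((+ ν / h) + (+ μ / m)))
B̄-distribution m h j μ = begin
  b                              ≡⟨ *-identityˡ b ⟨
  1ℚ * b                         ≡⟨ cong (_* b) H^j*r^j≡1 ⟨
  H ^ j * r ^ j * b              ≡⟨ *-assoc (H ^ j) (r ^ j) b ⟩
  H ^ j * (r ^ j * b)            ≡⟨ cong (λ y → H ^ j * (r ^ j * B̄ j y)) hμ/m≡h*[μ/m] ⟩
  H ^ j * (r ^ j * B̄ j (H * x))  ≡⟨ cong (_*_ (H ^ j)) (B̄-multiplication h j x) ⟩
  H ^ j * (r * (∑[ ν < h ] B̄ j (x + fromℕ ν * r)))
    ≡⟨ *-assoc (H ^ j) r _ ⟨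
  H ^ j * r * (∑[ ν < h ] B̄ j (x + fromℕ ν * r))
    ≡⟨ cong (_*_ (H ^ j * r)) (∑<-cong h (λ ν _ → cong (B̄ j) (trans (+-comm x (fromℕ ν * r)) (cong (_+ x) (sym (/-≡-* ν h)))))) ⟩
  H ^ j * r * (∑[ ν < h ] B̄ j ((+ ν / h) + x)) ∎
  where
  open ≡-Reasoning
  H = fromℕ h
  r = + 1 / h
  x = + μ / m
  b = B̄ j (+ (h ℕ.* μ) / m)
  H^j*r^j≡1 : H ^ j * r ^ j ≡ 1ℚ
  H^j*r^j≡1 = trans (sym (^-distrib-* H r j)) (trans (cong (_^ j) (n*1/n≡1 h)) (1^n≡1 j))
  hμ/m≡h*[μ/m] : + (h ℕ.* μ) / m ≡ H * x
  hμ/m≡h*[μ/m] = begin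
    + (h ℕ.* μ) / m              ≡⟨ /-≡-* (h ℕ.* μ) m ⟩
    fromℕ (h ℕ.* μ) * (+ 1 / m)  ≡⟨ cong (_* (+ 1 / m)) (fromℕ-* h μ) ⟩
    H * fromℕ μ * (+ 1 / m)      ≡⟨ *-assoc H (fromℕ μ) (+ 1 / m) ⟩
    H * (fromℕ μ * (+ 1 / m))    ≡⟨ cong (_*_ H) (/-≡-* μ m) ⟨
    H * x                        ∎

-- Dedekind sums

-- The additional term μ = 0 carries the factor 0/m; with it μ has the range of the double sum.
polyDedekindSum-from-0 : ∀ k p h m .{{_ : NonZero m}} →
  polyDedekindSum k p h m ≡ ∑[ μ < m ] ((+ μ / m) * polyB̄ k p (+ (h ℕ.* μ) / m))
polyDedekindSum-from-0 k p h m@(suc m-1) = sym (begin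
  (+ 0 / m) * b + S   ≡⟨ cong (λ a → a * b + S) (0/n≡0 m) ⟩
  0ℚ * b + S          ≡⟨ solve 2 (λ a b → con 0ℚ :* a :+ b := b) refl b S ⟩
  S                   ∎)
  where
  open ≡-Reasoning
  S = polyDedekindSum k p h m
  b = polyB̄ k p (+ (h ℕ.* 0) / m)

-- This is (mh)^(j-1), with natural exponents and separate reciprocals so that j = 0 needs no case
-- of its own.
scale : (m h j : ℕ) .{{_ : NonZero m}} .{{_ : NonZero h}} → ℚ
scale m h j = fromℕ m ^ j * fromℕ h ^ j * ((+ 1 / m) * (+ 1 / h))

-- One Dedekind sum alone already has the form of the right-hand side. Expanding the poly-Bernoulli
-- polynomial and distributing each Bernoulli value gives h^(j-1); splitting m^p as m^j m^(p-j), the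
-- factor m^j/m joins it, and h, μ and m^(p-j) remain as the weight.
half-reciprocity : ∀ (m h p : ℕ) .{{_ : NonZero m}} .{{_ : NonZero h}} k →
  fromℕ (h ℕ.* m ℕ.^ p) * polyDedekindSum k p h m
  ≡ ∑[ μ < m ] ∑[ j < suc p ] ∑[ ν < h ]
      (scale m h j * fromℕ (p C j) * polyBernoulliNumber k (p ∸ j)
        * fromℕ ((μ ℕ.* h) ℕ.* m ℕ.^ (p ∸ j)) * B̄ j ((+ ν / h) + (+ μ / m)))
half-reciprocity m h p k = begin
  N * polyDedekindSum k p h m
    ≡⟨ cong (_*_ N) (polyDedekindSum-from-0 k p h m) ⟩
  N * (∑[ μ < m ] ((+ μ / m) * polyB̄ k p (+ (h ℕ.* μ) / m)))
    ≡⟨ *-∑< m N (λ μ → (+ μ / m) * polyB̄ k p (+ (h ℕ.* μ) / m)) ⟩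
  ∑[ μ < m ] (N * ((+ μ / m) * polyB̄ k p (+ (h ℕ.* μ) / m)))
    ≡⟨ ∑<-cong m (λ μ _ → outer μ) ⟩
  ∑[ μ < m ] ∑[ j < suc p ] ∑[ ν < h ] term μ j ν ∎
  where
  open ≡-Reasoning
  M = fromℕ m
  H = fromℕ h
  N = fromℕ (h ℕ.* m ℕ.^ p)
  A = polyBernoulliNumber k
  c : ℕ → ℕ → ℚ
  c μ j = scale m h j * fromℕ (p C j) * A (p ∸ j) * fromℕ ((μ ℕ.* h) ℕ.* m ℕ.^ (p ∸ j))
  term : ℕ → ℕ → ℕ → ℚ
  term μ j ν = c μ j * B̄ j ((+ ν / h) + (+ μ / m))

  fromℕ-*-^ : ∀ a b n → fromℕ (a ℕ.* b ℕ.^ n) ≡ fromℕ a * fromℕ b ^ n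
  fromℕ-*-^ a b n = trans (fromℕ-* a (b ℕ.^ n)) (cong (_*_ (fromℕ a)) (fromℕ-^ b n))

  inner : ∀ μ j → j ℕ.≤ p →
    N * (+ μ / m) * (fromℕ (p C j) * B̄ j (+ (h ℕ.* μ) / m) * A (p ∸ j)) ≡ ∑[ ν < h ] term μ j ν
  inner μ j j≤p = begin
    N * (+ μ / m) * (κ * B̄ j (+ (h ℕ.* μ) / m) * A (p ∸ j))
      ≡⟨ cong₂ (λ a b → a * (κ * b * A (p ∸ j))) (cong₂ _*_ N≡ (/-≡-* μ m)) (B̄-distribution m h j μ) ⟩
    H * (M ^ j * M ^ (p ∸ j)) * (fromℕ μ * (+ 1 / m)) * (κ * (H ^ j * (+ 1 / h) * T) * A (p ∸ j))
      ≡⟨ solve 10 (λ H Mj Mp μ rm κ Hj rh T A →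
           H :* (Mj :* Mp) :* (μ :* rm) :* (κ :* (Hj :* rh :* T) :* A)
           := Mj :* Hj :* (rm :* rh) :* κ :* A :* (μ :* H :* Mp) :* T) refl
           H (M ^ j) (M ^ (p ∸ j)) (fromℕ μ) (+ 1 / m) κ (H ^ j) (+ 1 / h) T (A (p ∸ j)) ⟩
    scale m h j * κ * A (p ∸ j) * (fromℕ μ * H * M ^ (p ∸ j)) * T
      ≡⟨ cong (λ a → scale m h j * κ * A (p ∸ j) * a * T)
           (trans (fromℕ-*-^ (μ ℕ.* h) m (p ∸ j)) (cong (_* M ^ (p ∸ j)) (fromℕ-* μ h))) ⟨
    c μ j * T
      ≡⟨ *-∑< h (c μ j) (λ ν → B̄ j ((+ ν / h) + (+ μ / m))) ⟩
    ∑[ ν < h ] term μ j ν ∎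
    where
    κ = fromℕ (p C j)
    T = ∑[ ν < h ] B̄ j ((+ ν / h) + (+ μ / m))
    N≡ : N ≡ H * (M ^ j * M ^ (p ∸ j))
    N≡ = trans (fromℕ-*-^ h m p) (cong (_*_ H) (^-split M j≤p))

  outer : ∀ μ → N * ((+ μ / m) * polyB̄ k p (+ (h ℕ.* μ) / m)) ≡ ∑[ j < suc p ] ∑[ ν < h ] term μ j ν
  outer μ = begin
    N * ((+ μ / m) * polyB k p y)
      ≡⟨ *-assoc N (+ μ / m) (polyB k p y) ⟨
    N * (+ μ / m) * polyB k p y
      ≡⟨ cong (_*_ (N * (+ μ / m))) (polyB-expansion k p y) ⟩
    N * (+ μ / m) * (∑[ j < suc p ] (fromℕ (p C j) * B j y * A (p ∸ j)))
      ≡⟨ *-∑< (suc p) (N * (+ μ / m)) (λ j → fromℕ (p C j) * B j y * A (p ∸ j)) ⟩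
    ∑[ j < suc p ] (N * (+ μ / m) * (fromℕ (p C j) * B j y * A (p ∸ j)))
      ≡⟨ ∑<-cong (suc p) (λ j j≤p → inner μ j (ℕ.s≤s⁻¹ j≤p)) ⟩
    ∑[ j < suc p ] ∑[ ν < h ] term μ j ν ∎
    where y = ⟨ + (h ℕ.* μ) / m ⟩

-- Multiplying by n · 1/n raises the exponent to j ≥ 0, so j = 0 is treated uniformly.
^ℤ-pred : ∀ n .{{_ : NonZero n}} j → n ^ℤ (+ j ℤ.- + 1) ≡ fromℕ n ^ j * (+ 1 / n)
^ℤ-pred n j = begin
  z                                   ≡⟨ *-identityʳ z ⟨
  z * 1ℚ                              ≡⟨ cong (_*_ z) (n*1/n≡1 n) ⟨
  z * (fromℕ n * (+ 1 / n))
    ≡⟨ solve 3 (λ a b c → a :* (b :* c) := b :* a :* c) refl z (fromℕ n) (+ 1 / n) ⟩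
  fromℕ n * z * (+ 1 / n)             ≡⟨ cong (_* (+ 1 / n)) (^ℤ-suc n (+ j ℤ.- + 1)) ⟨
  n ^ℤ (+ j ℤ.- + 1 ℤ.+ + 1) * (+ 1 / n)
    ≡⟨ cong (λ i → n ^ℤ i * (+ 1 / n)) (trans (ℤ.+-assoc (+ j) (ℤ.- + 1) (+ 1)) (ℤ.+-identityʳ (+ j))) ⟩
  fromℕ (n ℕ.^ j) * (+ 1 / n)         ≡⟨ cong (_* (+ 1 / n)) (fromℕ-^ n j) ⟩
  fromℕ n ^ j * (+ 1 / n)             ∎
  where
  open ≡-Reasoning
  z = n ^ℤ (+ j ℤ.- + 1)

1/[m*n] : ∀ m n .{{_ : NonZero m}} .{{_ : NonZero n}} .{{_ : NonZero (m ℕ.* n)}} →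
  + 1 / (m ℕ.* n) ≡ (+ 1 / m) * (+ 1 / n)
1/[m*n] m n = begin
  x
    ≡⟨ solve 1 (λ x → x := x :* (con 1ℚ :* con 1ℚ)) refl x ⟩
  x * (1ℚ * 1ℚ)
    ≡⟨ cong₂ (λ a b → x * (a * b)) (n*1/n≡1 m) (n*1/n≡1 n) ⟨
  x * ((fromℕ m * y) * (fromℕ n * z))
    ≡⟨ solve 5 (λ x a y b z → x :* ((a :* y) :* (b :* z)) := a :* b :* x :* (y :* z))
         refl x (fromℕ m) y (fromℕ n) z ⟩
  fromℕ m * fromℕ n * x * (y * z)
    ≡⟨ cong (λ a → a * x * (y * z)) (fromℕ-* m n) ⟨
  fromℕ (m ℕ.* n) * x * (y * z)                   ≡⟨ cong (_* (y * z)) (n*1/n≡1 (m ℕ.* n)) ⟩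
  1ℚ * (y * z)                                    ≡⟨ *-identityˡ (y * z) ⟩
  y * z                                           ∎
  where
  open ≡-Reasoning
  x = + 1 / (m ℕ.* n)
  y = + 1 / m
  z = + 1 / n

^ℤ-scale : ∀ m h .{{_ : NonZero m}} .{{_ : NonZero h}} j →
  _^ℤ_ (m ℕ.* h) {{m*n≢0 m h}} (+ j ℤ.- + 1) ≡ scale m h j
^ℤ-scale m h j = begin
  (m ℕ.* h) ^ℤ (+ j ℤ.- + 1)                                ≡⟨ ^ℤ-pred (m ℕ.* h) j ⟩
  fromℕ (m ℕ.* h) ^ j * (+ 1 / (m ℕ.* h))
    ≡⟨ cong₂ (λ a b → a ^ j * b) (fromℕ-* m h) (1/[m*n] m h) ⟩
  (fromℕ m * fromℕ h) ^ j * ((+ 1 / m) * (+ 1 / h))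
    ≡⟨ cong (_* ((+ 1 / m) * (+ 1 / h))) (^-distrib-* (fromℕ m) (fromℕ h) j) ⟩
  scale m h j                                               ∎
  where
  open ≡-Reasoning
  instance _ = m*n≢0 m h

scale-comm : ∀ m h .{{_ : NonZero m}} .{{_ : NonZero h}} j → scale m h j ≡ scale h m j
scale-comm m h j = cong₂ _*_ (*-comm (fromℕ m ^ j) (fromℕ h ^ j)) (*-comm (+ 1 / m) (+ 1 / h))

theorem10 : (m h p : ℕ) .{{_ : NonZero m}} .{{_ : NonZero h}} .{{_ : NonZero p}} (k : ℤ) →
    fromℕ (h ℕ.* m ℕ.^ p) * polyDedekindSum k p h m
      + fromℕ (m ℕ.* h ℕ.^ p) * polyDedekindSum k p m h
    ≡ ∑[ μ < m ] ∑[ j < suc p ] ∑[ ν < h ] ∑[1≤ l ≤ suc (p ∸ j) ]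
        (_^ℤ_ (m ℕ.* h) {{m*n≢0 m h}} (+ j ℤ.- + 1) * fromℕ (p C j) * S₁ (suc (p ∸ j)) l)
          * ((+ 1 / suc (p ∸ j)) * l ^ℤ (ℤ.- (k ℤ.- + 1)))
          * fromℕ ((μ ℕ.* h) ℕ.* m ℕ.^ (p ∸ j) ℕ.+ (m ℕ.* ν) ℕ.* h ℕ.^ (p ∸ j))
          * B̄ j ((+ ν / h) + (+ μ / m))
theorem10 m h p k = begin
  fromℕ (h ℕ.* m ℕ.^ p) * polyDedekindSum k p h m
    + fromℕ (m ℕ.* h ℕ.^ p) * polyDedekindSum k p m h
    -- The second use exchanges m and h, so its outer index is ν and its inner one μ; `rearrange`
    -- restores the common order.
    ≡⟨ cong₂ _+_ (half-reciprocity m h p k) (half-reciprocity h m p k) ⟩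
  (∑[ μ < m ] ∑[ j < suc p ] ∑[ ν < h ] X μ j ν) + (∑[ ν < h ] ∑[ j < suc p ] ∑[ μ < m ] Y ν j μ)
    ≡⟨ cong (_+_ (∑[ μ < m ] ∑[ j < suc p ] ∑[ ν < h ] X μ j ν)) rearrange ⟩
  (∑[ μ < m ] ∑[ j < suc p ] ∑[ ν < h ] X μ j ν) + (∑[ μ < m ] ∑[ j < suc p ] ∑[ ν < h ] Y ν j μ)
    ≡⟨ ∑<-+ m (λ μ → ∑[ j < suc p ] ∑[ ν < h ] X μ j ν) (λ μ → ∑[ j < suc p ] ∑[ ν < h ] Y ν j μ) ⟨
  ∑[ μ < m ] ((∑[ j < suc p ] ∑[ ν < h ] X μ j ν) + (∑[ j < suc p ] ∑[ ν < h ] Y ν j μ))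
    ≡⟨ ∑<-cong m (λ μ _ → trans
         (sym (∑<-+ (suc p) (λ j → ∑[ ν < h ] X μ j ν) (λ j → ∑[ ν < h ] Y ν j μ)))
         (∑<-cong (suc p) (λ j _ → trans
           (sym (∑<-+ h (X μ j) (λ ν → Y ν j μ)))
           (∑<-cong h (λ ν _ → combine μ j ν))))) ⟩
  ∑[ μ < m ] ∑[ j < suc p ] ∑[ ν < h ] ∑[ l < suc (p ∸ j) ] Z μ j ν l ∎
  where
  open ≡-Reasoning
  A = polyBernoulliNumber k
  X Y : ℕ → ℕ → ℕ → ℚ
  X μ j ν = scale m h j * fromℕ (p C j) * A (p ∸ j)
    * fromℕ ((μ ℕ.* h) ℕ.* m ℕ.^ (p ∸ j)) * B̄ j ((+ ν / h) + (+ μ / m))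
  Y ν j μ = scale h m j * fromℕ (p C j) * A (p ∸ j)
    * fromℕ ((ν ℕ.* m) ℕ.* h ℕ.^ (p ∸ j)) * B̄ j ((+ μ / m) + (+ ν / h))
  Z : ℕ → ℕ → ℕ → ℕ → ℚ
  Z μ j ν l = (_^ℤ_ (m ℕ.* h) {{m*n≢0 m h}} (+ j ℤ.- + 1) * fromℕ (p C j) * S₁ (suc (p ∸ j)) (suc l))
    * ((+ 1 / suc (p ∸ j)) * suc l ^ℤ (ℤ.- (k ℤ.- + 1)))
    * fromℕ ((μ ℕ.* h) ℕ.* m ℕ.^ (p ∸ j) ℕ.+ (m ℕ.* ν) ℕ.* h ℕ.^ (p ∸ j))
    * B̄ j ((+ ν / h) + (+ μ / m))

  rearrange : ∑[ ν < h ] ∑[ j < suc p ] ∑[ μ < m ] Y ν j μ ≡ ∑[ μ < m ] ∑[ j < suc p ] ∑[ ν < h ] Y ν j μ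
  rearrange = begin
    ∑[ ν < h ] ∑[ j < suc p ] ∑[ μ < m ] Y ν j μ
      ≡⟨ ∑<-comm h (suc p) (λ ν j → ∑[ μ < m ] Y ν j μ) ⟩
    ∑[ j < suc p ] ∑[ ν < h ] ∑[ μ < m ] Y ν j μ
      ≡⟨ ∑<-cong (suc p) (λ j _ → ∑<-comm h m (λ ν μ → Y ν j μ)) ⟩
    ∑[ j < suc p ] ∑[ μ < m ] ∑[ ν < h ] Y ν j μ
      ≡⟨ ∑<-comm (suc p) m (λ j μ → ∑[ ν < h ] Y ν j μ) ⟩
    ∑[ μ < m ] ∑[ j < suc p ] ∑[ ν < h ] Y ν j μ ∎

  combine : ∀ μ j ν → X μ j ν + Y ν j μ ≡ ∑[ l < suc (p ∸ j) ] Z μ j ν l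
  combine μ j ν = begin
    s * c * a * x * b + scale h m j * c * a * fromℕ ((ν ℕ.* m) ℕ.* h ℕ.^ (p ∸ j)) * B̄ j ((+ μ / m) + (+ ν / h))
      -- Undoing the exchange of m and h: the power of mh, the product νm and, next, the argument of
      -- `B̄ j` are symmetric, so both terms share every factor except the weights x and y.
      ≡⟨ cong₂ (λ u v → s * c * a * x * b + u * c * a * fromℕ (v ℕ.* h ℕ.^ (p ∸ j)) * B̄ j ((+ μ / m) + (+ ν / h))) (scale-comm h m j) (ℕ.*-comm ν m) ⟩
    s * c * a * x * b + s * c * a * y * B̄ j ((+ μ / m) + (+ ν / h))
      ≡⟨ cong (λ u → s * c * a * x * b + s * c * a * y * B̄ j u) (+-comm (+ μ / m) (+ ν / h)) ⟩
    s * c * a * x * b + s * c * a * y * b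
      ≡⟨ solve 6 (λ s c a x y b → s :* c :* a :* x :* b :+ s :* c :* a :* y :* b := s :* c :* ((x :+ y) :* b) :* a)
           refl s c a x y b ⟩
    s * c * ((x + y) * b) * a
      ≡⟨ cong₂ (λ u v → u * c * (v * b) * a) (sym (^ℤ-scale m h j)) (sym (fromℕ-+ ((μ ℕ.* h) ℕ.* m ℕ.^ (p ∸ j)) ((m ℕ.* ν) ℕ.* h ℕ.^ (p ∸ j)))) ⟩
    w * c * (n * b) * a
      -- Only here is the coefficient `a` opened into its Stirling sum, which produces the index l.
      ≡⟨ *-∑< (suc (p ∸ j)) (w * c * (n * b)) summand ⟩
    ∑[ l < suc (p ∸ j) ] (w * c * (n * b) * summand l)
      ≡⟨ ∑<-cong (suc (p ∸ j)) (λ l _ → solve 6 (λ w c n b S q → w :* c :* (n :* b) :* (S :* q) := w :* c :* S :* q :* n :* b) refl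
           w c n b (S₁ (suc (p ∸ j)) (suc l)) ((+ 1 / suc (p ∸ j)) * suc l ^ℤ (ℤ.- (k ℤ.- + 1)))) ⟩
    ∑[ l < suc (p ∸ j) ] Z μ j ν l ∎
    where
    s = scale m h j
    w = _^ℤ_ (m ℕ.* h) {{m*n≢0 m h}} (+ j ℤ.- + 1)
    c = fromℕ (p C j)
    a = A (p ∸ j)
    x = fromℕ ((μ ℕ.* h) ℕ.* m ℕ.^ (p ∸ j))
    y = fromℕ ((m ℕ.* ν) ℕ.* h ℕ.^ (p ∸ j))
    n = fromℕ ((μ ℕ.* h) ℕ.* m ℕ.^ (p ∸ j) ℕ.+ (m ℕ.* ν) ℕ.* h ℕ.^ (p ∸ j))
    b = B̄ j ((+ ν / h) + (+ μ / m))
    summand : ℕ → ℚ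
    summand l = S₁ (suc (p ∸ j)) (suc l) * ((+ 1 / suc (p ∸ j)) * suc l ^ℤ (ℤ.- (k ℤ.- + 1)))
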